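{- (i) Let $I,J$ be sets and $R\colon I\times J\to[0,1]$ a fuzzy relation. Then the mappings $d_R\colon[0,1]^I\to[0,1]^J$ and $h_R\colon[0,1]^J\to[0,1]^I$ satisfy $d_R\rightleftharpoons h_R$. (ii) Let $\mathbf A$ and $\mathbf B$ be semisimple Pavelka algebras and let $d\colon A\to B$, $h\colon B\to A$ satisfy $d\rightleftharpoons h$. Then there exists a fuzzy relation $R\colon\mathrm{Spec_M}\mathbf A\times\mathrm{Spec_M}\mathbf B\to[0,1]$ (namely $R(F,G)=\bigvee_{a\in A}(d(a)/G\cdot a/F)$) such that $n_{\mathbf B}(d(x))=d_R(n_{\mathbf A}(x))$ for all $x\in A$ and $n_{\mathbf A}(h(y))=h_R(n_{\mathbf B}(y))$ for all $y\in B$, with $I=\mathrm{Spec_M}\mathbf A$, $J=\mathrm{Spec_M}\mathbf B$.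
   Context: An MV-algebra $(A;\oplus,\neg,0)$ carries derived operations $1=\neg0$, $x\cdot y=\neg(\neg x\oplus\neg y)$, $x\rightarrow y=\neg x\oplus y$, lattice operations $x\vee y=\neg(\neg x\oplus y)\oplus y$, $x\wedge y=\neg(\neg x\vee\neg y)$, order $x\le y$ iff $\neg x\oplus y=1$. The standard MV-algebra is $[0,1]$ with $x\oplus y=\min\{x+y,1\}$, $\neg x=1-x$. A Pavelka algebra is $\mathbf A=(A;\oplus,\neg,\{\mathbf r\mid r\in[0,1]\cap\mathbb Q\})$ with $(A;\oplus,\neg,\mathbf 0)$ an MV-algebra, $\mathbf r\oplus\mathbf s=\mathbf t$ whenever $\min\{r+s,1\}=t$, and $\neg\mathbf r=\mathbf s$ whenever $1-r=s$. The standard Pavelka algebra is $[0,1]$ with $\mathbf r$ interpreted as $r$; $[0,1]^I$ is its power. Filters are filters of the MV-reduct (nonempty up-sets closed under $\cdot$); $\mathrm{Spec_M}\mathbf A$ is the set of maximal proper filters; for $F\in\mathrm{Spec_M}\mathbf A$, $\mathbf A/F$ embeds uniquely into $[0,1]$ and $x/F$ is identified with its image. $\mathbf A$ is semisimple if its MV-reduct is a subdirect product of simple MV-algebras. Natural embedding: $n_{\mathbf A}(x)(F)=x/F$. For $d\colon A\to B$, $h\colon B\to A$: $d\rightleftharpoons h$ means $d,h$ are antitone, $x\le d(y)$ iff $y\le h(x)$ for all $y\in A$, $x\in B$, and $\mathbf r\rightarrow d(x)=d(\mathbf r\cdot x)$ for all $x\in A$ and constants $\mathbf r$ (equivalently $\mathbf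 r\rightarrow h(y)=h(\mathbf r\cdot y)$ for all $y\in B$). For $R\colon I\times J\to[0,1]$: $d_R(x)(j)=\bigwedge_{i\in I}(x(i)\rightarrow R(i,j))$ for $x\in[0,1]^I$; $h_R(y)(i)=\bigwedge_{j\in J}(y(j)\rightarrow R(i,j))$ for $y\in[0,1]^J$. -}

module Defs where

open import Level using (Level; _⊔_; 0ℓ) renaming (suc to lsuc)
open import Algebra.Bundles using (CommutativeRing)
open import Algebra.Definitions using (Congruent₁; Congruent₂; Involutive; RightZero)
open import Algebra.Structures using (IsCommutativeMonoid)
open import Axiom.ExcludedMiddle using (ExcludedMiddle)
open import Data.Empty using (⊥-elim)
open import Data.Integer.Base as ℤ using (+_)
import Data.Integer.Properties as ℤ
open import Data.Nat.Base as ℕ using (ℕ; zero; suc)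
import Data.Nat.Properties as ℕ
open import Data.Product.Base using (∃; ∃₂; _×_; _,_; proj₁; proj₂; swap)
open import Data.Rational.Base using (ℚ; mkℚ; 0ℚ; 1ℚ; _+_; -_; _-_; _⊓_; _≤_; _<_; toℚᵘ; *<*)
open import Data.Rational.Properties
open import Data.Rational.Solver using (module +-*-Solver)
open import Data.Rational.Unnormalised.Base as ℚᵘ using (mkℚᵘ; *≡*; *≤*)
import Data.Rational.Unnormalised.Properties as ℚᵘ
open import Data.Sum.Base using (_⊎_; inj₁; inj₂; [_,_]′)
open import Function.Base using (_∘_; id)
open import Function.Bundles using (_⇔_)
open import Function.Definitions using (Congruent; Surjective)
open import Relation.Binary.Bundles using (Poset)
open import Relation.Binary.Core using (Rel) renaming (_⇒_ to _⇒ʳ_)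
open import Relation.Binary.PropositionalEquality.Core using (_≡_; refl; sym; trans; cong; subst; subst₂)
open import Relation.Binary.Structures using (IsEquivalence)
open import Relation.Nullary.Decidable.Core using (yes; no; True; toWitness; fromWitness)
open import Relation.Nullary.Negation.Core using (¬_)
open import Relation.Unary using (Pred; _∈_; _∉_; _⊆_; _≐_)
open import Algebra.Properties.Semiring.Mult (CommutativeRing.semiring +-*-commutativeRing) using (×-assoc-*; ×-congʳ) renaming (_×_ to _·ℕ_)
open +-*-Solver using (solve; _:=_; _:+_; _:-_; :-_; con)

private
  variable
    c ℓ c₁ ℓ₁ c₂ ℓ₂ i j : Level

Zorn : ∀ c ℓ₁ ℓ₂ p → Set (lsuc (c ⊔ ℓ₁ ⊔ ℓ₂ ⊔ p))
Zorn c ℓ₁ ℓ₂ p = (P : Poset c ℓ₁ ℓ₂) → let open Poset P renaming (_≤_ to _⊑_) in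
  ((C : Pred Carrier p) → (∀ {x y} → x ∈ C → y ∈ C → x ⊑ y ⊎ y ⊑ x) →
    ∃ λ u → ∀ {x} → x ∈ C → x ⊑ u) →
  ∃ λ m → ∀ {x} → m ⊑ x → x ⊑ m

record IsMVAlgebra {A : Set c} (_≈_ : Rel A ℓ) (_⊕_ : A → A → A) (∼_ : A → A) (𝟘 : A) : Set (c ⊔ ℓ) where
  field
    isCommutativeMonoid : IsCommutativeMonoid _≈_ _⊕_ 𝟘
    ∼-cong              : Congruent₁ _≈_ ∼_
    ∼-involutive        : Involutive _≈_ ∼_
    ⊕-zeroʳ             : RightZero _≈_ (∼ 𝟘) _⊕_
    łukasiewicz         : ∀ x y → ((∼ ((∼ x) ⊕ y)) ⊕ y) ≈ ((∼ ((∼ y) ⊕ x)) ⊕ x)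

  open IsCommutativeMonoid isCommutativeMonoid public

record MVAlgebra c ℓ : Set (lsuc (c ⊔ ℓ)) where
  infix 8 ∼_
  infixl 7 _·_
  infixl 6 _⊕_ _∨_ _∧_
  infixr 5 _⇒_
  infix 4 _≈_ _≼_
  field
    Carrier     : Set c
    _≈_         : Rel Carrier ℓ
    _⊕_         : Carrier → Carrier → Carrier
    ∼_          : Carrier → Carrier
    𝟘           : Carrier
    isMVAlgebra : IsMVAlgebra _≈_ _⊕_ ∼_ 𝟘

  open IsMVAlgebra isMVAlgebra public

  𝟙 : Carrier
  𝟙 = ∼ 𝟘

  _·_ _⇒_ _∨_ _∧_ : Carrier → Carrier → Carrier
  x · y = ∼ (∼ x ⊕ ∼ y)
  x ⇒ y = ∼ x ⊕ y
  x ∨ y = ∼ (∼ x ⊕ y) ⊕ y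
  x ∧ y = ∼ (∼ x ∨ ∼ y)

  _≼_ : Rel Carrier ℓ
  x ≼ y = ∼ x ⊕ y ≈ 𝟙

record IsMVHomomorphism (A : MVAlgebra c₁ ℓ₁) (B : MVAlgebra c₂ ℓ₂)
    (f : MVAlgebra.Carrier A → MVAlgebra.Carrier B) : Set (c₁ ⊔ ℓ₁ ⊔ ℓ₂) where
  private
    module A = MVAlgebra A
    module B = MVAlgebra B
  field
    f-cong : Congruent A._≈_ B._≈_ f
    ⊕-homo : ∀ x y → f (x A.⊕ y) B.≈ f x B.⊕ f y
    ∼-homo : ∀ x → f (A.∼ x) B.≈ B.∼ f x
    𝟘-homo : f A.𝟘 B.≈ B.𝟘

record IsMVCongruence (A : MVAlgebra c ℓ) {r} (_θ_ : Rel (MVAlgebra.Carrier A) r) : Set (c ⊔ ℓ ⊔ r) where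
  open MVAlgebra A using (_≈_; _⊕_; ∼_)
  field
    isEquivalence : IsEquivalence _θ_
    reflexive     : _≈_ ⇒ʳ _θ_
    ⊕-cong        : Congruent₂ _θ_ _⊕_
    ∼-cong        : Congruent₁ _θ_ ∼_

record IsSimple (A : MVAlgebra c ℓ) : Set (lsuc (c ⊔ ℓ)) where
  open MVAlgebra A using (Carrier; _≈_)
  field
    nontrivial : ¬ (∀ x y → x ≈ y)
    congruence : {_θ_ : Rel Carrier (c ⊔ ℓ)} → IsMVCongruence A _θ_ →
                 (_θ_ ⇒ʳ _≈_) ⊎ (∀ x y → x θ y)

-- A subdirect embedding of A into ∏ₖ factor k, given by its components.
record SubdirectProductOfSimples (A : MVAlgebra c ℓ) k c′ ℓ′ : Set (c ⊔ ℓ ⊔ lsuc (k ⊔ c′ ⊔ ℓ′)) where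
  private module A = MVAlgebra A
  field
    Index      : Set k
    factor     : Index → MVAlgebra c′ ℓ′
    simple     : ∀ k → IsSimple (factor k)
    π          : ∀ k → A.Carrier → MVAlgebra.Carrier (factor k)
    π-homo     : ∀ k → IsMVHomomorphism A (factor k) (π k)
    π-onto     : ∀ k → Surjective A._≈_ (MVAlgebra._≈_ (factor k)) (π k)
    separating : ∀ {x y} → (∀ k → MVAlgebra._≈_ (factor k) (π k x) (π k y)) → x A.≈ y

module _ (A : MVAlgebra c ℓ) where
  open MVAlgebra A

  record IsFilter {r} (F : Pred Carrier r) : Set (c ⊔ ℓ ⊔ r) where
    field
      nonempty : ∃ λ x → x ∈ F
      upward   : ∀ {x y} → x ∈ F → x ≼ y → y ∈ F
      ·-closed : ∀ {x y} → x ∈ F → y ∈ F → x · y ∈ F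

  Proper : ∀ {r} → Pred Carrier r → Set (c ⊔ r)
  Proper F = ¬ (∀ x → x ∈ F)

  -- Under excluded middle every predicate is equivalent to one of any given level, so
  -- fixing the level of the subsets of A (here and in IsSimple) loses nothing.
  record MaximalFilter : Set (lsuc (c ⊔ ℓ)) where
    field
      member   : Pred Carrier (c ⊔ ℓ)
      isFilter : IsFilter member
      proper   : Proper member
      maximal  : {G : Pred Carrier (c ⊔ ℓ)} → IsFilter G → Proper G → member ⊆ G → G ⊆ member

ℚ[0,1] : Set
ℚ[0,1] = ∃ λ r → 0ℚ ≤ r × r ≤ 1ℚ

0ᴵ 1ᴵ : ℚ[0,1]
0ᴵ = 0ℚ , ≤-refl , <⇒≤ (positive⁻¹ 1ℚ)
1ᴵ = 1ℚ , <⇒≤ (positive⁻¹ 1ℚ) , ≤-refl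

record PavelkaAlgebra c ℓ : Set (lsuc (c ⊔ ℓ)) where
  field
    Carrier     : Set c
    _≈_         : Rel Carrier ℓ
    _⊕_         : Carrier → Carrier → Carrier
    ∼_          : Carrier → Carrier
    const       : ℚ[0,1] → Carrier
    isMVAlgebra : IsMVAlgebra _≈_ _⊕_ ∼_ (const 0ᴵ)
    const-⊕     : ∀ {r s t} → (proj₁ r + proj₁ s) ⊓ 1ℚ ≡ proj₁ t → (const r ⊕ const s) ≈ const t
    const-∼     : ∀ {r s} → 1ℚ - proj₁ r ≡ proj₁ s → (∼ const r) ≈ const s

  mvAlgebra : MVAlgebra c ℓ
  mvAlgebra = record { isMVAlgebra = isMVAlgebra }

  open MVAlgebra mvAlgebra public hiding (Carrier; _≈_; _⊕_; ∼_; isMVAlgebra)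

Semisimple : PavelkaAlgebra c ℓ → ∀ k c′ ℓ′ → Set (c ⊔ ℓ ⊔ lsuc (k ⊔ c′ ⊔ ℓ′))
Semisimple A = SubdirectProductOfSimples (PavelkaAlgebra.mvAlgebra A)

SpecM : (A : PavelkaAlgebra c ℓ) → Set (lsuc (c ⊔ ℓ))
SpecM A = MaximalFilter (PavelkaAlgebra.mvAlgebra A)

infix 4 _≈ˢ_
_≈ˢ_ : {A : PavelkaAlgebra c ℓ} → Rel (SpecM A) (c ⊔ ℓ)
F ≈ˢ G = MaximalFilter.member F ≐ MaximalFilter.member G

module _ (A : PavelkaAlgebra c₁ ℓ₁) (B : PavelkaAlgebra c₂ ℓ₂) where
  private
    module A = PavelkaAlgebra A
    module B = PavelkaAlgebra B

  record IsPavelkaHomomorphism (f : A.Carrier → B.Carrier) : Set (c₁ ⊔ ℓ₁ ⊔ ℓ₂) where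
    field
      isMVHomomorphism : IsMVHomomorphism A.mvAlgebra B.mvAlgebra f
      const-homo       : ∀ r → f (A.const r) B.≈ B.const r

  infix 4 [_,_]_⇌_
  record [_,_]_⇌_ (d : A.Carrier → B.Carrier) (h : B.Carrier → A.Carrier) : Set (c₁ ⊔ ℓ₁ ⊔ c₂ ⊔ ℓ₂) where
    field
      d-antitone : ∀ {x y} → x A.≼ y → d y B.≼ d x
      h-antitone : ∀ {x y} → x B.≼ y → h y A.≼ h x
      galois     : ∀ x y → x B.≼ d y ⇔ y A.≼ h x
      d-const    : ∀ r x → (B.const r B.⇒ d x) B.≈ d (A.const r A.· x)

power : PavelkaAlgebra c ℓ → Set i → PavelkaAlgebra (c ⊔ i) (ℓ ⊔ i)
power A I = record
  { Carrier     = I → Carrier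
  ; _≈_         = λ x y → ∀ k → x k ≈ y k
  ; _⊕_         = λ x y k → x k ⊕ y k
  ; ∼_          = λ x k → ∼ x k
  ; const       = λ r _ → const r
  ; isMVAlgebra = record
    { isCommutativeMonoid = record
      { isMonoid = record
        { isSemigroup = record
          { isMagma = record
            { isEquivalence = record
              { refl  = λ _ → A.refl
              ; sym   = λ p k → A.sym (p k)
              ; trans = λ p q k → A.trans (p k) (q k)
              }
            ; ∙-cong = λ p q k → ∙-cong (p k) (q k)
            }
          ; assoc = λ x y z k → assoc (x k) (y k) (z k)
          }
        ; identity = (λ x k → identityˡ (x k)) , (λ x k → identityʳ (x k))
        }
      ; comm = λ x y k → comm (x k) (y k)
      }
    ; ∼-cong       = λ p k → ∼-cong (p k)
    ; ∼-involutive = λ x k → ∼-involutive (x k)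
    ; ⊕-zeroʳ      = λ x k → ⊕-zeroʳ (x k)
    ; łukasiewicz  = λ x y k → łukasiewicz (x k) (y k)
    }
  ; const-⊕     = λ {r} {s} {t} p _ → const-⊕ {r} {s} {t} p
  ; const-∼     = λ {r} {s} p _ → const-∼ {r} {s} p
  }
  where
  module A = PavelkaAlgebra A
  open A hiding (refl; sym; trans)

shift-≤ : ∀ {a b c d} → c ≤ d → a + d ≡ b + c → a ≤ b
shift-≤ {a} {b} {c} {d} c≤d eq = subst₂ _≤_
  (trans (cong (_- d) (sym eq)) (solve 2 (λ a d → a :+ d :- d := a) refl a d))
  (solve 2 (λ b d → b :+ d :- d := b) refl b d)
  (+-monoˡ-≤ (- d) (+-monoʳ-≤ b c≤d))

shift-< : ∀ {a b c d} → c < d → a + d ≡ b + c → a < b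
shift-< {a} {b} {c} {d} c<d eq = subst₂ _<_
  (trans (cong (_- d) (sym eq)) (solve 2 (λ a d → a :+ d :- d := a) refl a d))
  (solve 2 (λ b d → b :+ d :- d := b) refl b d)
  (+-monoˡ-< (- d) (+-monoʳ-< b c<d))

diff<0 : ∀ {p q} → p < q → p - q < 0ℚ
diff<0 {p} {q} p<q = subst (p - q <_) (+-inverseʳ q) (+-monoˡ-< (- q) p<q)

0<diff : ∀ {p q} → p < q → 0ℚ < q - p
0<diff {p} {q} p<q = subst (_< q - p) (+-inverseʳ p) (+-monoˡ-< (- p) p<q)

p≡q+[p-q] : ∀ p q → p ≡ q + (p - q)
p≡q+[p-q] = solve 2 (λ p q → p := q :+ (p :- q)) refl

p≡p-q+q : ∀ p q → p ≡ p - q + q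
p≡p-q+q = solve 2 (λ p q → p := p :- q :+ q) refl

≤-q+[p-q] : ∀ p q → p ≤ q + (p - q)
≤-q+[p-q] p q = ≤-reflexive (p≡q+[p-q] p q)

≤-p-q+q : ∀ p q → p ≤ p - q + q
≤-p-q+q p q = ≤-reflexive (p≡p-q+q p q)

n·1 : ∀ n → toℚᵘ (n ·ℕ 1ℚ) ℚᵘ.≃ mkℚᵘ (+ n) 0
n·1 zero = *≡* refl
n·1 (suc n) = ℚᵘ.≃-trans (toℚᵘ-homo-+ 1ℚ (n ·ℕ 1ℚ))
  (ℚᵘ.≃-trans (ℚᵘ.+-congʳ (toℚᵘ 1ℚ) (n·1 n)) (*≡* (cong (ℤ._* + 1) (cong (λ m → + 1 ℤ.+ m) (ℤ.*-identityʳ (+ n))))))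

archimedean : ∀ {ε} → 0ℚ < ε → ∃ λ n → 1ℚ ≤ n ·ℕ ε
archimedean {ε@(mkℚ (+ suc a) d _)} 0<ε = suc d , subst (1ℚ ≤_)
  (trans (×-assoc-* (suc d) 1ℚ ε) (×-congʳ (suc d) (*-identityˡ ε)))
  (toℚᵘ-cancel-≤ (ℚᵘ.≤-trans step (ℚᵘ.≤-reflexive (ℚᵘ.≃-sym
    (ℚᵘ.≃-trans (toℚᵘ-homo-* (suc d ·ℕ 1ℚ) ε) (ℚᵘ.*-congʳ {toℚᵘ ε} (n·1 (suc d))))))))
  where
  step : toℚᵘ 1ℚ ℚᵘ.≤ mkℚᵘ (+ suc d) 0 ℚᵘ.* toℚᵘ ε
  step = *≤* (subst₂ ℤ._≤_ (sym (ℤ.*-identityˡ (+ (1 ℕ.* suc d))))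
    (trans (ℤ.pos-* (suc d) (suc a)) (sym (ℤ.*-identityʳ (+ suc d ℤ.* + suc a))))
    (ℤ.+≤+ (subst (ℕ._≤ suc d ℕ.* suc a) (sym (ℕ.*-identityˡ (suc d))) (ℕ.m≤m*n (suc d) (suc a)))))
archimedean {mkℚ (+ zero) d _} (*<* (ℤ.+<+ ()))
archimedean {mkℚ (ℤ.-[1+ n ]) d _} (*<* ())

between : ∀ {p a b} → p < a → p < b → ∃ λ t → p < t × t < a × t < b
between {p} {a} {b} p<a p<b with <-dense p<a | <-dense p<b
... | s , p<s , s<a | t , p<t , t<b with s ≤? t
... | yes s≤t = s , p<s , s<a , ≤-<-trans s≤t t<b
... | no  s≰t = t , p<t , <-trans (≰⇒> s≰t) s<a , t<b

-- A real number x ∈ [0,1] as its lower Dedekind cut { p ∈ ℚ ∣ p < x }.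
record 𝕀 : Set₁ where
  field
    lower   : Pred ℚ 0ℓ
    neg     : ∀ {p} → p < 0ℚ → p ∈ lower
    bounded : ∀ {p} → p ∈ lower → p < 1ℚ
    down    : ∀ {p q} → p ≤ q → q ∈ lower → p ∈ lower
    rounded : ∀ {p} → p ∈ lower → ∃ λ q → p < q × q ∈ lower

open 𝕀

infix 4 _≈ᴵ_
_≈ᴵ_ : Rel 𝕀 0ℓ
x ≈ᴵ y = lower x ≐ lower y

constᴵ : ℚ[0,1] → 𝕀
constᴵ (r , 0≤r , r≤1) = record
  { lower   = _< r
  ; neg     = λ p<0 → <-≤-trans p<0 0≤r
  ; bounded = λ p<r → <-≤-trans p<r r≤1
  ; down    = ≤-<-trans
  ; rounded = <-dense
  }

-- min (x + y) 1
infixl 6 _⊕ᴵ_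
_⊕ᴵ_ : 𝕀 → 𝕀 → 𝕀
x ⊕ᴵ y = record
  { lower   = λ p → p < 1ℚ × ∃₂ λ q r → q ∈ lower x × r ∈ lower y × p ≤ q + r
  ; neg     = λ {p} p<0 → let (q , p<q , q<0) = <-dense p<0 in
      <-trans p<0 (positive⁻¹ 1ℚ) , q , p - q , neg x q<0 ,
      neg y (diff<0 p<q) ,
      ≤-q+[p-q] p q
  ; bounded = proj₁
  ; down    = λ { p≤p′ (p′<1 , q , r , q∈x , r∈y , p′≤) →
      ≤-<-trans p≤p′ p′<1 , q , r , q∈x , r∈y , ≤-trans p≤p′ p′≤ }
  ; rounded = λ { (p<1 , q , r , q∈x , r∈y , p≤) →
      let (q′ , q<q′ , q′∈x) = rounded x q∈x
          (t , p<t , t<1 , t<) = between p<1 (≤-<-trans p≤ (+-monoˡ-< r q<q′))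
      in t , p<t , t<1 , q′ , r , q′∈x , r∈y , <⇒≤ t< }
  }

-- 1 - x
infix 8 ∼ᴵ_
∼ᴵ_ : 𝕀 → 𝕀
∼ᴵ x = record
  { lower   = λ p → ∃ λ q → q ∉ lower x × p < 1ℚ - q
  ; neg     = λ p<0 → 1ℚ , (λ 1∈x → <-irrefl refl (bounded x 1∈x)) , p<0
  ; bounded = λ { (q , q∉x , p<) → <-≤-trans p<
      (+-monoʳ-≤ 1ℚ (neg-antimono-≤ (≮⇒≥ (λ q<0 → q∉x (neg x q<0))))) }
  ; down    = λ { p≤p′ (q , q∉x , p′<) → q , q∉x , ≤-<-trans p≤p′ p′< }
  ; rounded = λ { (q , q∉x , p<) → let (t , p<t , t<) = <-dense p< in t , p<t , q , q∉x , t< }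
  }

module Classical (em : ∀ {ℓ} → ExcludedMiddle ℓ) where

  stable : {P : Set ℓ} → ¬ ¬ P → P
  stable {P = P} ¬¬p with em {P = P}
  ... | yes p = p
  ... | no ¬p = ⊥-elim (¬¬p ¬p)

  ∉-≥ : ∀ x {p q} → p ∈ lower x → q ∉ lower x → p < q
  ∉-≥ x p∈x q∉x = ≰⇒> (λ q≤p → q∉x (down x q≤p p∈x))

  locate : ∀ x {ε} → 0ℚ < ε → ∃ λ q → q ∈ lower x × q + ε ∉ lower x
  locate x {ε} 0<ε with archimedean 0<ε
  ... | n , 1≤nε = go (suc n) (- ε) (neg x (neg-antimono-< 0<ε)) (≤-trans 1≤nε (≤-reflexive
      (solve 2 (λ ε m → m := :- ε :+ (ε :+ m)) refl ε (n ·ℕ ε))))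
    where
    go : ∀ n q → q ∈ lower x → 1ℚ ≤ q + n ·ℕ ε → ∃ λ q → q ∈ lower x × q + ε ∉ lower x
    go zero    q q∈x 1≤ = ⊥-elim (<-irrefl refl (≤-<-trans 1≤ (subst (_< 1ℚ) (sym (+-identityʳ q)) (bounded x q∈x))))
    go (suc n) q q∈x 1≤ with em {P = q + ε ∈ lower x}
    ... | yes q+ε∈x = go n (q + ε) q+ε∈x (≤-trans 1≤ (≤-reflexive (sym (+-assoc q ε _))))
    ... | no  q+ε∉x = q , q∈x , q+ε∉x

  ⊕ᴵ-mono : ∀ x x′ y y′ → lower x ⊆ lower x′ → lower y ⊆ lower y′ → lower (x ⊕ᴵ y) ⊆ lower (x′ ⊕ᴵ y′)
  ⊕ᴵ-mono x x′ y y′ x⊆ y⊆ (p<1 , q , r , q∈ , r∈ , p≤) = p<1 , q , r , x⊆ q∈ , y⊆ r∈ , p≤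

  ∼ᴵ-cong : ∀ x x′ → x ≈ᴵ x′ → ∼ᴵ x ≈ᴵ ∼ᴵ x′
  ∼ᴵ-cong x x′ (x⊆ , ⊆x) =
    (λ { (q , q∉ , p<) → q , q∉ ∘ ⊆x , p< }) , (λ { (q , q∉ , p<) → q , q∉ ∘ x⊆ , p< })

  ⊕ᴵ-comm-⊆ : ∀ x y → lower (x ⊕ᴵ y) ⊆ lower (y ⊕ᴵ x)
  ⊕ᴵ-comm-⊆ x y (p<1 , q , r , q∈x , r∈y , p≤) =
    p<1 , r , q , r∈y , q∈x , ≤-trans p≤ (≤-reflexive (+-comm q r))

  ⊕ᴵ-comm : ∀ x y → x ⊕ᴵ y ≈ᴵ y ⊕ᴵ x
  ⊕ᴵ-comm x y = ⊕ᴵ-comm-⊆ x y , ⊕ᴵ-comm-⊆ y x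

  ⊕ᴵ-assoc-⊆ : ∀ x y z → lower ((x ⊕ᴵ y) ⊕ᴵ z) ⊆ lower (x ⊕ᴵ (y ⊕ᴵ z))
  ⊕ᴵ-assoc-⊆ x y z {p} (p<1 , q , r , (q<1 , a , b , a∈x , b∈y , q≤) , r∈z , p≤) =
    helper (large a a∈x)
    where
    p-1<0 : p - 1ℚ < 0ℚ
    p-1<0 = diff<0 p<1

    large : ∀ a → a ∈ lower x → ∃ λ a′ → a′ ∈ lower x × a ≤ a′ × p - 1ℚ < a′
    large a a∈x = let (s , p-1<s , s<0) = <-dense p-1<0 in
      [ (λ s≤a → a , a∈x , ≤-refl , <-≤-trans p-1<s s≤a)
      , (λ a≤s → s , neg x s<0 , a≤s , p-1<s)
      ]′ (≤-total s a)

    p≤abr : p ≤ a + (b + r)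
    p≤abr = ≤-trans p≤ (≤-trans (+-monoˡ-≤ r q≤) (≤-reflexive (+-assoc a b r)))

    helper : (∃ λ a′ → a′ ∈ lower x × a ≤ a′ × p - 1ℚ < a′) → p ∈ lower (x ⊕ᴵ (y ⊕ᴵ z))
    helper (a′ , a′∈x , a≤a′ , p-1<a′) =
      p<1 , a′ , p - a′ , a′∈x ,
      ( shift-< p-1<a′ (solve 3 (λ o p a → p :- a :+ a := o :+ (p :- o)) refl 1ℚ p a′)
      , b , r , b∈y , r∈z
      , shift-≤ (≤-trans p≤abr (+-monoˡ-≤ (b + r) a≤a′))
          (solve 3 (λ p a s → p :- a :+ (a :+ s) := s :+ p) refl p a′ (b + r)) ) ,
      ≤-q+[p-q] p a′

  ⊕ᴵ-assoc : ∀ x y z → (x ⊕ᴵ y) ⊕ᴵ z ≈ᴵ x ⊕ᴵ (y ⊕ᴵ z)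
  ⊕ᴵ-assoc x y z = ⊕ᴵ-assoc-⊆ x y z ,
    λ p∈ → ⊕ᴵ-comm-⊆ z (x ⊕ᴵ y) (⊕ᴵ-mono z z (y ⊕ᴵ x) (x ⊕ᴵ y) id (⊕ᴵ-comm-⊆ y x)
             (⊕ᴵ-assoc-⊆ z y x (⊕ᴵ-mono (y ⊕ᴵ z) (z ⊕ᴵ y) x x (⊕ᴵ-comm-⊆ y z) id
               (⊕ᴵ-comm-⊆ x (y ⊕ᴵ z) p∈))))

  ⊕ᴵ-identityʳ : ∀ x → x ⊕ᴵ constᴵ 0ᴵ ≈ᴵ x
  ⊕ᴵ-identityʳ x =
    (λ { (p<1 , q , r , q∈x , r<0 , p≤) → down x (≤-trans p≤ (≤-trans (+-monoʳ-≤ q (<⇒≤ r<0)) (≤-reflexive (+-identityʳ q)))) q∈x }) ,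
    (λ {p} p∈x → let (q , p<q , q∈x) = rounded x p∈x in
      bounded x p∈x , q , p - q , q∈x ,
      diff<0 p<q ,
      ≤-q+[p-q] p q)

  ⊕ᴵ-identityˡ : ∀ x → constᴵ 0ᴵ ⊕ᴵ x ≈ᴵ x
  ⊕ᴵ-identityˡ x =
    proj₁ (⊕ᴵ-identityʳ x) ∘ ⊕ᴵ-comm-⊆ (constᴵ 0ᴵ) x , ⊕ᴵ-comm-⊆ x (constᴵ 0ᴵ) ∘ proj₂ (⊕ᴵ-identityʳ x)

  ∼ᴵ-involutive : ∀ x → ∼ᴵ ∼ᴵ x ≈ᴵ x
  ∼ᴵ-involutive x =
    (λ { {p} (q , q∉∼x , p<) → stable λ p∉x → q∉∼x (p , p∉x ,
      shift-< p< (solve 3 (λ o p q → q :+ (o :- q) := o :- p :+ p) refl 1ℚ p q)) }) ,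
    (λ {p} p∈x → let (p′ , p<p′ , p′∈x) = rounded x p∈x in
      1ℚ - p′ ,
      (λ { (r , r∉x , lt) → r∉x (down x (<⇒≤ (shift-< lt
        (solve 3 (λ o r p → r :+ (o :- r) := p :+ (o :- p)) refl 1ℚ r p′))) p′∈x) }) ,
      shift-< p<p′ (solve 3 (λ o p q → p :+ q := o :- (o :- q) :+ p) refl 1ℚ p p′))

  ∼ᴵ-const : ∀ {r s} → 1ℚ - proj₁ r ≡ proj₁ s → ∼ᴵ constᴵ r ≈ᴵ constᴵ s
  ∼ᴵ-const {r , _} {s , _} eq =
    (λ { (q , q≮r , p<) → <-≤-trans p< (subst (1ℚ - q ≤_) eq (+-monoʳ-≤ 1ℚ (neg-antimono-≤ (≮⇒≥ q≮r)))) }) ,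
    (λ {p} p<s → r , <-irrefl refl , subst (p <_) (sym eq) p<s)

  ∼ᴵ0≈1 : ∼ᴵ constᴵ 0ᴵ ≈ᴵ constᴵ 1ᴵ
  ∼ᴵ0≈1 = ∼ᴵ-const {0ᴵ} {1ᴵ} refl

  ⊕ᴵ-zeroʳ : ∀ x → x ⊕ᴵ ∼ᴵ constᴵ 0ᴵ ≈ᴵ ∼ᴵ constᴵ 0ᴵ
  ⊕ᴵ-zeroʳ x = (λ { (p<1 , _) → proj₂ ∼ᴵ0≈1 p<1 }) ,
    (λ {p} p∈1 → let p<1 = proj₁ ∼ᴵ0≈1 p∈1
                     (q , p-1<q , q<0) = <-dense (diff<0 p<1)
      in p<1 , q , p - q , neg x q<0 ,
         proj₂ ∼ᴵ0≈1 (shift-< p-1<q (solve 3 (λ o p q → p :- q :+ q := o :+ (p :- o)) refl 1ℚ p q)) ,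
         ≤-q+[p-q] p q)

  ∨ᴵ-upper : ∀ x y → lower y ⊆ lower (∼ᴵ (∼ᴵ x ⊕ᴵ y) ⊕ᴵ y)
  ∨ᴵ-upper x y {p} p∈y = let (q , p<q , q∈y) = rounded y p∈y in
    bounded y p∈y , p - q , q ,
    neg (∼ᴵ (∼ᴵ x ⊕ᴵ y)) (diff<0 p<q) ,
    q∈y , ≤-p-q+q p q

  ∨ᴵ-swap : ∀ x y → lower x ⊆ lower (∼ᴵ (∼ᴵ x ⊕ᴵ y) ⊕ᴵ y)
  ∨ᴵ-swap x y {p} p∈x =
    let (p′ , p<p′ , p′∈x) = rounded x p∈x
        (ε , 0<ε , ε<) = <-dense (0<diff p<p′)
        (r , r∈y , r+ε∉y) = locate y 0<ε
    in bounded x p∈x , p - r , r ,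
       ( 1ℚ - p′ + (r + ε)
       , (λ { (_ , u , v , (w , w∉x , u<) , v∈y , ≤u+v) → <-irrefl refl (≤-<-trans ≤u+v
             (+-mono-< (<-trans u< (+-monoʳ-< 1ℚ (neg-antimono-< (∉-≥ x p′∈x w∉x)))) (∉-≥ y v∈y r+ε∉y))) })
       , shift-< ε< (solve 5 (λ o p p′ r ε → p :- r :+ (p′ :- p) := o :- (o :- p′ :+ (r :+ ε)) :+ ε) refl 1ℚ p p′ r ε) ) ,
       r∈y , ≤-p-q+q p r

  ∨ᴵ-least : ∀ x y {p} → p ∈ lower (∼ᴵ (∼ᴵ x ⊕ᴵ y) ⊕ᴵ y) → p ∉ lower y → p ∈ lower x
  ∨ᴵ-least x y {p} (p<1 , q , r , (s , s∉ , q<) , r∈y , p≤) p∉y = stable ¬p∉x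
    where
    s-r<1-p : s - r < 1ℚ - p
    s-r<1-p = shift-< (≤-<-trans p≤ (+-monoˡ-< r q<))
      (solve 4 (λ o s r p → s :- r :+ (o :- s :+ r) := o :- p :+ p) refl 1ℚ s r p)
    q+r≤r : 1ℚ ≤ s → q + r ≤ r
    q+r≤r 1≤s = ≤-trans (+-monoˡ-≤ r (≤-trans (<⇒≤ q<) (+-monoʳ-≤ 1ℚ (neg-antimono-≤ 1≤s)))) (≤-reflexive (+-identityˡ r))
    ¬p∉x : ¬ (p ∉ lower x)
    ¬p∉x p∉x with s <? 1ℚ
    ... | yes s<1 = s∉ (s<1 , s - r , r , (p , p∉x , s-r<1-p) , r∈y ,
      ≤-p-q+q s r)
    ... | no  s≮1 = p∉y (down y (≤-trans p≤ (q+r≤r (≮⇒≥ s≮1))) r∈y)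

  łukasiewiczᴵ-⊆ : ∀ x y → lower (∼ᴵ (∼ᴵ x ⊕ᴵ y) ⊕ᴵ y) ⊆ lower (∼ᴵ (∼ᴵ y ⊕ᴵ x) ⊕ᴵ x)
  łukasiewiczᴵ-⊆ x y {p} p∈ with em {P = p ∈ lower y}
  ... | yes p∈y = ∨ᴵ-swap y x p∈y
  ... | no  p∉y = ∨ᴵ-upper y x (∨ᴵ-least x y p∈ p∉y)

  const-⊕ᴵ : ∀ {r s t} → (proj₁ r + proj₁ s) ⊓ 1ℚ ≡ proj₁ t → constᴵ r ⊕ᴵ constᴵ s ≈ᴵ constᴵ t
  const-⊕ᴵ {r , _} {s , _} {t , _} eq =
    (λ {p} (p<1 , a , b , a<r , b<s , p≤) → subst (p <_) eq
      (⊓-< (≤-<-trans p≤ (+-mono-< a<r b<s)) p<1)) ,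
    (λ {p} p<t → let p<⊓ = subst (p <_) (sym eq) p<t
                     p<r+s = <-≤-trans p<⊓ (p⊓q≤p (r + s) 1ℚ)
                     (q , p-s<q , q<r) = <-dense (shift-< {p - s} {r} p<r+s (solve 3 (λ p r s → p :- s :+ (r :+ s) := r :+ p) refl p r s))
      in <-≤-trans p<⊓ (p⊓q≤q (r + s) 1ℚ) , q , p - q , q<r ,
         shift-< p-s<q (solve 3 (λ p q s → p :- q :+ q := s :+ (p :- s)) refl p q s) ,
         ≤-q+[p-q] p q)
    where
    ⊓-< : ∀ {p a b} → p < a → p < b → p < a ⊓ b
    ⊓-< {p} {a} {b} p<a p<b with ⊓-sel a b
    ... | inj₁ eq = subst (p <_) (sym eq) p<a
    ... | inj₂ eq = subst (p <_) (sym eq) p<b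

  [0,1] : PavelkaAlgebra (lsuc 0ℓ) 0ℓ
  [0,1] = record
    { Carrier     = 𝕀
    ; _≈_         = _≈ᴵ_
    ; _⊕_         = _⊕ᴵ_
    ; ∼_          = ∼ᴵ_
    ; const       = constᴵ
    ; isMVAlgebra = record
      { isCommutativeMonoid = record
        { isMonoid = record
          { isSemigroup = record
            { isMagma = record
              { isEquivalence = record
                { refl  = id , id
                ; sym   = swap
                ; trans = λ (p , p′) (q , q′) → q ∘ p , p′ ∘ q′
                }
              ; ∙-cong = λ {x} {x′} {y} {y′} (x⊆ , ⊆x) (y⊆ , ⊆y) →
                  ⊕ᴵ-mono x x′ y y′ x⊆ y⊆ , ⊕ᴵ-mono x′ x y′ y ⊆x ⊆y
              }
            ; assoc = ⊕ᴵ-assoc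
            }
          ; identity = ⊕ᴵ-identityˡ , ⊕ᴵ-identityʳ
          }
        ; comm = ⊕ᴵ-comm
        }
      ; ∼-cong       = λ {x} {y} → ∼ᴵ-cong x y
      ; ∼-involutive = ∼ᴵ-involutive
      ; ⊕-zeroʳ      = ⊕ᴵ-zeroʳ
      ; łukasiewicz  = λ x y → łukasiewiczᴵ-⊆ x y , łukasiewiczᴵ-⊆ y x
      }
    ; const-⊕     = λ {r} {s} {t} → const-⊕ᴵ {r} {s} {t}
    ; const-∼     = λ {r} {s} → ∼ᴵ-const {r} {s}
    }

  open PavelkaAlgebra [0,1] public using () renaming (_≼_ to _≼ᴵ_; _·_ to _·ᴵ_; _⇒_ to _⇒ᴵ_)

  ≼ᴵ⇒⊆ : ∀ x y → x ≼ᴵ y → lower x ⊆ lower y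
  ≼ᴵ⇒⊆ x y (_ , 1⊆) {p} p∈x = go (rounded x p∈x)
    where
    go : (∃ λ p′ → p < p′ × p′ ∈ lower x) → p ∈ lower y
    go (p′ , p<p′ , p′∈x) with 1⊆ (proj₂ ∼ᴵ0≈1 t<1)
      where
      t<1 : 1ℚ - (p′ - p) < 1ℚ
      t<1 = +-monoʳ-< 1ℚ (neg-antimono-< (0<diff p<p′))
    ... | _ , q , r , (s , s∉x , q<) , r∈y , t≤ = down y (shift-≤ (≤-trans t≤ (+-monoˡ-≤ r (<⇒≤
      (<-trans q< (+-monoʳ-< 1ℚ (neg-antimono-< (∉-≥ x p′∈x s∉x)))))))
      (solve 4 (λ o p p′ r → p :+ (o :- p′ :+ r) := r :+ (o :- (p′ :- p))) refl 1ℚ p p′ r)) r∈y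

  ⊆⇒≼ᴵ : ∀ x y → lower x ⊆ lower y → x ≼ᴵ y
  ⊆⇒≼ᴵ x y x⊆y = proj₂ ∼ᴵ0≈1 ∘ proj₁ , λ {t} t∈1 →
    let t<1 = proj₁ ∼ᴵ0≈1 t∈1
        (ε , 0<ε , ε<) = <-dense (0<diff t<1)
        (s , s∈x , s+ε∉x) = locate x 0<ε
    in t<1 , t - s , s ,
       (s + ε , s+ε∉x , shift-< ε< (solve 4 (λ o t s ε → t :- s :+ (o :- t) := o :- (s :+ ε) :+ ε) refl 1ℚ t s ε)) ,
       x⊆y s∈x , ≤-p-q+q t s

  -- Bounds of families indexed by types of any level; True em brings the defining
  -- condition down to Set.
  ⋀ : {I : Set i} → (I → 𝕀) → 𝕀
  ⋀ {I = I} f = record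
    { lower   = λ p → True (em {P = Below p})
    ; neg     = λ p<0 → let (q , p<q , q<0) = <-dense p<0 in
        fromWitness (q , p<q , <⇒≤ (<-trans q<0 (positive⁻¹ 1ℚ)) , λ k → neg (f k) q<0)
    ; bounded = λ p∈ → let (q , p<q , q≤1 , _) = toWitness p∈ in <-≤-trans p<q q≤1
    ; down    = λ p≤p′ p′∈ → let (q , p′<q , rest) = toWitness p′∈ in
        fromWitness (q , ≤-<-trans p≤p′ p′<q , rest)
    ; rounded = λ p∈ → let (q , p<q , rest) = toWitness p∈ ; (t , p<t , t<q) = <-dense p<q in
        t , p<t , fromWitness (q , t<q , rest)
    }
    where
    Below : ℚ → Set _
    Below p = ∃ λ q → p < q × q ≤ 1ℚ × ∀ k → q ∈ lower (f k)

  ⋁ : {I : Set i} → (I → 𝕀) → 𝕀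
  ⋁ {I = I} f = record
    { lower   = λ p → True (em {P = Below p})
    ; neg     = λ p<0 → fromWitness (inj₁ p<0)
    ; bounded = λ p∈ → bounded′ (toWitness p∈)
    ; down    = λ p≤p′ p′∈ → fromWitness (down′ p≤p′ (toWitness p′∈))
    ; rounded = λ p∈ → let (q , p<q , q∈) = rounded′ (toWitness p∈) in q , p<q , fromWitness q∈
    }
    where
    Below : ℚ → Set _
    Below p = p < 0ℚ ⊎ ∃ λ k → p ∈ lower (f k)
    bounded′ : ∀ {p} → Below p → p < 1ℚ
    bounded′ (inj₁ p<0)      = <-trans p<0 (positive⁻¹ 1ℚ)
    bounded′ (inj₂ (k , p∈)) = bounded (f k) p∈
    down′ : ∀ {p q} → p ≤ q → Below q → Below p
    down′ p≤q (inj₁ q<0)      = inj₁ (≤-<-trans p≤q q<0)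
    down′ p≤q (inj₂ (k , q∈)) = inj₂ (k , down (f k) p≤q q∈)
    rounded′ : ∀ {p} → Below p → ∃ λ q → p < q × Below q
    rounded′ (inj₁ p<0)      = let (q , p<q , q<0) = <-dense p<0 in q , p<q , inj₁ q<0
    rounded′ (inj₂ (k , p∈)) = let (q , p<q , q∈) = rounded (f k) p∈ in q , p<q , inj₂ (k , q∈)

  ⋀-lower : {I : Set i} (f : I → 𝕀) → ∀ k → ⋀ f ≼ᴵ f k
  ⋀-lower f k = ⊆⇒≼ᴵ (⋀ f) (f k) λ p∈ →
    let (q , p<q , _ , q∈) = toWitness p∈ in down (f k) (<⇒≤ p<q) (q∈ k)

  ⋀-greatest : {I : Set i} (f : I → 𝕀) → ∀ x → (∀ k → x ≼ᴵ f k) → x ≼ᴵ ⋀ f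
  ⋀-greatest f x x≼f = ⊆⇒≼ᴵ x (⋀ f) λ p∈x →
    let (q , p<q , q∈x) = rounded x p∈x in
    fromWitness (q , p<q , <⇒≤ (bounded x q∈x) , λ k → ≼ᴵ⇒⊆ x (f k) (x≼f k) q∈x)

  ⋁-upper : {I : Set i} (f : I → 𝕀) → ∀ k → f k ≼ᴵ ⋁ f
  ⋁-upper f k = ⊆⇒≼ᴵ (f k) (⋁ f) λ p∈ → fromWitness (inj₂ (k , p∈))

  ⋁-least : {I : Set i} (f : I → 𝕀) → ∀ x → (∀ k → f k ≼ᴵ x) → ⋁ f ≼ᴵ x
  ⋁-least {I = I} f x f≼x = ⊆⇒≼ᴵ (⋁ f) x λ p∈ → go (toWitness p∈)
    where
    go : ∀ {p} → (p < 0ℚ ⊎ ∃ λ k → p ∈ lower (f k)) → p ∈ lower x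
    go (inj₁ p<0)      = neg x p<0
    go (inj₂ (k , p∈)) = ≼ᴵ⇒⊆ (f k) x (f≼x k) p∈

  [0,1]^_ : (I : Set i) → PavelkaAlgebra (lsuc 0ℓ ⊔ i) i
  [0,1]^ I = power [0,1] I

  module _ {I : Set i} {J : Set j} (R : I → J → 𝕀) where

    d[_] : (I → 𝕀) → (J → 𝕀)
    d[_] x j = ⋀ λ i → x i ⇒ᴵ R i j

    h[_] : (J → 𝕀) → (I → 𝕀)
    h[_] y i = ⋀ λ j → y j ⇒ᴵ R i j

  module _ (A : PavelkaAlgebra c ℓ) where
    open PavelkaAlgebra A

    -- The quotient A/F is A with x/F = y/F iff x ⇒ y and y ⇒ x lie in F, so an
    -- embedding of A/F is a homomorphism on A which identifies exactly these pairs.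
    record QuotientEmbedding (F : SpecM A) : Set (lsuc 0ℓ ⊔ c ⊔ ℓ) where
      open MaximalFilter F using (member)
      field
        embed          : Carrier → 𝕀
        isHomomorphism : IsPavelkaHomomorphism A [0,1] embed
        kernel         : ∀ x y → (x ⇒ y ∈ member × y ⇒ x ∈ member) ⇔ embed x ≈ᴵ embed y

    -- x/F as a real number: its image under the unique embedding of A/F.  Every
    -- maximal filter has one, so the second clause is never reached.
    quotient : Carrier → SpecM A → 𝕀
    quotient x F with em {P = QuotientEmbedding F}
    ... | yes e = QuotientEmbedding.embed e x
    ... | no  _ = constᴵ 0ᴵ

    n[_] : Carrier → (SpecM A → 𝕀)
    n[_] x F = quotient x F

module Submission where

-- Part (i) is residuation in [0,1].  For part (ii), a maximal filter F of a Pavelka algebra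
-- embeds the quotient into [0,1] by x ↦ sup { r ∣ 𝐫 ⇒ x ∈ F }, because the quotient is linearly
-- ordered and F is maximal.  The inequality n(d x) ≤ d_R(n x) is immediate; conversely, let
-- d(x)/G < t and v = 𝐭 · x, so that d(v) ∉ G.  As d turns joins into meets, U = { u ∣ d(u) ∈ G }
-- is a lattice ideal, and by prelinearity some maximal F contains all u ⇒ v with u ∈ U as well
-- as ∼ 𝐭 ⇒ x.  For a rational q < d(a)/G we have 𝐪 · a ∈ U, so d(a)/G · a/F ≤ v/F for every a,
-- that is, R(F,G) ≤ v/F, whence x/F → R(F,G) ≤ x/F → t · x/F = t ∨ ¬ x/F = t.
-- The second equation is the first one for the swapped pair (h, d).

open import Defs
open import Level using (Level; _⊔_; Lift; lift; 0ℓ)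
open import Algebra.Bundles using (CommutativeRing)
open import Axiom.ExcludedMiddle using (ExcludedMiddle)
open import Data.Empty using (⊥; ⊥-elim)
open import Data.Nat.Base using (zero; suc)
open import Data.Product.Base using (∃; _×_; _,_; proj₁; proj₂; swap)
open import Data.Rational.Base using (ℚ; 0ℚ; 1ℚ; _+_; _-_; _⊓_; _≤_; _<_) renaming (_⊔_ to _⊔ℚ_)
open import Data.Rational.Properties hiding (module ≤-Reasoning)
open import Data.Rational.Solver using (module +-*-Solver)
open import Data.Sum.Base using (_⊎_; inj₁; inj₂)
open import Function.Base using (_∘_; id)
open import Function.Bundles using (_⇔_; Equivalence; mk⇔)
open import Relation.Binary.Bundles using (Poset)
open import Relation.Binary.Core using (_Preserves₂_⟶_⟶_)
open import Relation.Binary.PropositionalEquality.Core as ≡ using (_≡_)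
open import Relation.Nullary.Decidable.Core using (yes; no; True; toWitness; fromWitness)
open import Relation.Nullary.Negation.Core using (¬_)
open import Relation.Unary using (Pred; _∈_; _∉_; _⊆_; _≐_)
open import Algebra.Properties.Semiring.Mult (CommutativeRing.semiring +-*-commutativeRing) using () renaming (_×_ to _·ℕ_)
open +-*-Solver using (solve; _:=_; _:+_; _:-_; con)
import Relation.Binary.Reasoning.PartialOrder as ≤-Reasoning
import Relation.Binary.Reasoning.Setoid as ≈-Reasoning

open 𝕀

private
  variable
    c ℓ c₁ ℓ₁ c₂ ℓ₂ i j : Level

-- The natural order of an MV-algebra.

module MVOrder (M : MVAlgebra c ℓ) where
  open MVAlgebra M
  open ≈-Reasoning setoid

  -- The Łukasiewicz axiom for `x` and `𝟙`: one side is absorbed by `⊕-zeroʳ`, and in the other the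
  -- summand `∼ 𝟙` vanishes.
  ∼-complement : ∀ x → ∼ x ⊕ x ≈ 𝟙
  ∼-complement x = begin
    ∼ x ⊕ x               ≈⟨ ∙-congʳ (∼-cong (trans (∙-congʳ (∼-involutive 𝟘)) (identityˡ x))) ⟨
    ∼ (∼ 𝟙 ⊕ x) ⊕ x       ≈⟨ łukasiewicz x 𝟙 ⟨
    ∼ (∼ x ⊕ 𝟙) ⊕ 𝟙       ≈⟨ ⊕-zeroʳ _ ⟩
    𝟙                     ∎

  ⊕-zeroˡ : ∀ x → 𝟙 ⊕ x ≈ 𝟙
  ⊕-zeroˡ x = trans (comm 𝟙 x) (⊕-zeroʳ x)

  𝟙⇒ : ∀ x → (𝟙 ⇒ x) ≈ x
  𝟙⇒ x = trans (∙-congʳ (∼-involutive 𝟘)) (identityˡ x)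

  ≼-respˡ : ∀ {x y z} → x ≈ y → x ≼ z → y ≼ z
  ≼-respˡ x≈y x≼z = trans (∙-congʳ (∼-cong (sym x≈y))) x≼z

  ≼-respʳ : ∀ {x y z} → x ≈ y → z ≼ x → z ≼ y
  ≼-respʳ x≈y z≼x = trans (∙-congˡ (sym x≈y)) z≼x

  ≼-reflexive : ∀ {x y} → x ≈ y → x ≼ y
  ≼-reflexive {x} x≈y = ≼-respʳ x≈y (∼-complement x)

  ≼-refl : ∀ {x} → x ≼ x
  ≼-refl = ≼-reflexive refl

  ≼⇒∨≈ : ∀ {x y} → x ≼ y → (x ∨ y) ≈ y
  ≼⇒∨≈ {x} {y} x≼y = trans (∙-congʳ (∼-cong x≼y)) (𝟙⇒ y)

  -- An explicit summand that takes `x` up to `y`, obtained from the symmetry of the join. It turns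
  -- the order into divisibility with respect to `⊕`, so that transitivity and monotonicity become
  -- rearrangements of sums.
  ≼-split : ∀ {x y} → x ≼ y → y ≈ x ⊕ ∼ (∼ y ⊕ x)
  ≼-split {x} {y} x≼y = trans (sym (≼⇒∨≈ x≼y)) (trans (łukasiewicz x y) (comm _ x))

  x≼x⊕y : ∀ x y → x ≼ x ⊕ y
  x≼x⊕y x y = begin
    ∼ x ⊕ (x ⊕ y)  ≈⟨ assoc _ _ _ ⟨
    ∼ x ⊕ x ⊕ y    ≈⟨ ∙-congʳ (∼-complement x) ⟩
    𝟙 ⊕ y          ≈⟨ ⊕-zeroˡ y ⟩
    𝟙              ∎

  -- Each inequality identifies one of the two joins with its larger argument, and `łukasiewicz`
  -- says that the join is symmetric.
  ≼-antisym : ∀ {x y} → x ≼ y → y ≼ x → x ≈ y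
  ≼-antisym {x} {y} x≼y y≼x = trans (sym (≼⇒∨≈ y≼x)) (trans (łukasiewicz y x) (≼⇒∨≈ x≼y))

  ≼-trans : ∀ {x y z} → x ≼ y → y ≼ z → x ≼ z
  ≼-trans {x} {y} {z} x≼y y≼z = ≼-respʳ (begin
    x ⊕ (∼ (∼ y ⊕ x) ⊕ ∼ (∼ z ⊕ y))  ≈⟨ assoc _ _ _ ⟨
    x ⊕ ∼ (∼ y ⊕ x) ⊕ ∼ (∼ z ⊕ y)    ≈⟨ ∙-congʳ (≼-split x≼y) ⟨
    y ⊕ ∼ (∼ z ⊕ y)                  ≈⟨ ≼-split y≼z ⟨
    z                                ∎) (x≼x⊕y x _)

  ≼-poset : Poset c ℓ ℓ
  ≼-poset = record
    { _≈_ = _≈_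
    ; _≤_ = _≼_
    ; isPartialOrder = record
      { isPreorder = record
        { isEquivalence = isEquivalence
        ; reflexive     = ≼-reflexive
        ; trans         = ≼-trans
        }
      ; antisym = ≼-antisym
      }
    }

-- Residuation, divisibility, prelinearity and joins.

module MVProperties (M : MVAlgebra c ℓ) where
  open MVAlgebra M
  open MVOrder M public
  open ≤-Reasoning ≼-poset

  ⊕-monoˡ : ∀ {x y} z → x ≼ y → x ⊕ z ≼ y ⊕ z
  ⊕-monoˡ {x} {y} z x≼y = ≼-respʳ (begin-equality
    x ⊕ z ⊕ ∼ (∼ y ⊕ x)    ≈⟨ assoc _ _ _ ⟩
    x ⊕ (z ⊕ ∼ (∼ y ⊕ x))  ≈⟨ ∙-congˡ (comm _ _) ⟩
    x ⊕ (∼ (∼ y ⊕ x) ⊕ z)  ≈⟨ assoc _ _ _ ⟨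
    x ⊕ ∼ (∼ y ⊕ x) ⊕ z    ≈⟨ ∙-congʳ (≼-split x≼y) ⟨
    y ⊕ z                  ∎) (x≼x⊕y (x ⊕ z) _)

  ⊕-monoʳ : ∀ {x y} z → x ≼ y → z ⊕ x ≼ z ⊕ y
  ⊕-monoʳ z x≼y = ≼-respˡ (comm _ z) (≼-respʳ (comm _ z) (⊕-monoˡ z x≼y))

  ⊕-mono : ∀ {x y u v} → x ≼ y → u ≼ v → x ⊕ u ≼ y ⊕ v
  ⊕-mono {y = y} {u = u} x≼y u≼v = ≼-trans (⊕-monoˡ u x≼y) (⊕-monoʳ y u≼v)

  ∼-antitone : ∀ {x y} → x ≼ y → ∼ y ≼ ∼ x
  ∼-antitone {x} {y} x≼y = trans (∙-congʳ (∼-involutive y)) (trans (comm y (∼ x)) x≼y)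

  ≼𝟙 : ∀ {x} → x ≼ 𝟙
  ≼𝟙 = ⊕-zeroʳ _

  𝟘≼ : ∀ {x} → 𝟘 ≼ x
  𝟘≼ = ⊕-zeroˡ _

  𝟙≼⇒≈𝟙 : ∀ {x} → 𝟙 ≼ x → x ≈ 𝟙
  𝟙≼⇒≈𝟙 = ≼-antisym ≼𝟙

  ·-cong : ∀ {x y u v} → x ≈ y → u ≈ v → x · u ≈ y · v
  ·-cong x≈y u≈v = ∼-cong (∙-cong (∼-cong x≈y) (∼-cong u≈v))

  ·-mono : ∀ {x y u v} → x ≼ y → u ≼ v → x · u ≼ y · v
  ·-mono x≼y u≼v = ∼-antitone (⊕-mono (∼-antitone x≼y) (∼-antitone u≼v))

  ·-comm : ∀ x y → x · y ≈ y · x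
  ·-comm x y = ∼-cong (comm _ _)

  ·-assoc : ∀ x y z → x · y · z ≈ x · (y · z)
  ·-assoc x y z = ∼-cong (begin-equality
    ∼ ∼ (∼ x ⊕ ∼ y) ⊕ ∼ z    ≈⟨ ∙-congʳ (∼-involutive _) ⟩
    ∼ x ⊕ ∼ y ⊕ ∼ z          ≈⟨ assoc _ _ _ ⟩
    ∼ x ⊕ (∼ y ⊕ ∼ z)        ≈⟨ ∙-congˡ (∼-involutive _) ⟨
    ∼ x ⊕ ∼ ∼ (∼ y ⊕ ∼ z)    ∎)

  ⇒-curry : ∀ x y z → (x · y ⇒ z) ≈ (x ⇒ (y ⇒ z))
  ⇒-curry x y z = trans (∙-congʳ (∼-involutive _)) (assoc _ _ _)

  residuate : ∀ {x y z} → x · y ≼ z → x ≼ (y ⇒ z)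
  residuate = trans (sym (⇒-curry _ _ _))

  unresiduate : ∀ {x y z} → x ≼ (y ⇒ z) → x · y ≼ z
  unresiduate = trans (⇒-curry _ _ _)

  ⇒-swap : ∀ {x y z} → x ≼ (y ⇒ z) → y ≼ (x ⇒ z)
  ⇒-swap = residuate ∘ ≼-respˡ (·-comm _ _) ∘ unresiduate

  ⇒-mono : ∀ {x y u v} → y ≼ x → u ≼ v → (x ⇒ u) ≼ (y ⇒ v)
  ⇒-mono y≼x u≼v = ⊕-mono (∼-antitone y≼x) u≼v

  ⇒-contrapositive : ∀ x y → (x ⇒ y) ≈ (∼ y ⇒ ∼ x)
  ⇒-contrapositive x y = trans (comm _ _) (∙-congʳ (sym (∼-involutive y)))

  modus-ponens : ∀ x y → x · (x ⇒ y) ≼ y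
  modus-ponens x y = ≼-respˡ (·-comm _ _) (unresiduate ≼-refl)

  weaken : ∀ x y → y ≼ (x ⇒ y)
  weaken x y = ≼-respʳ (comm _ _) (x≼x⊕y y (∼ x))

  x·y≼x : ∀ x y → x · y ≼ x
  x·y≼x x y = unresiduate (weaken y x)

  x·y≼y : ∀ x y → x · y ≼ y
  x·y≼y x y = ≼-respˡ (·-comm _ _) (x·y≼x y x)

  ⇒-trans : ∀ x y z → (x ⇒ y) · (y ⇒ z) ≼ (x ⇒ z)
  ⇒-trans x y z = residuate (begin
    (x ⇒ y) · (y ⇒ z) · x    ≈⟨ ·-comm _ _ ⟩
    x · ((x ⇒ y) · (y ⇒ z))  ≈⟨ ·-assoc _ _ _ ⟨
    x · (x ⇒ y) · (y ⇒ z)    ≤⟨ ·-mono (modus-ponens x y) ≼-refl ⟩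
    y · (y ⇒ z)              ≤⟨ modus-ponens y z ⟩
    z                        ∎)

  -- Both products are the meet of `x` and `y`: this is `łukasiewicz` for the complements `∼ y` and
  -- `∼ x`, negated.
  ·-divisible : ∀ x y → x · (x ⇒ y) ≈ y · (y ⇒ x)
  ·-divisible x y = ∼-cong (begin-equality
    ∼ x ⊕ ∼ (∼ x ⊕ y)          ≈⟨ comm _ _ ⟩
    ∼ (∼ x ⊕ y) ⊕ ∼ x          ≈⟨ ∙-congʳ (∼-cong (⇒-contrapositive x y)) ⟩
    ∼ (∼ ∼ y ⊕ ∼ x) ⊕ ∼ x      ≈⟨ łukasiewicz (∼ y) (∼ x) ⟩
    ∼ (∼ ∼ x ⊕ ∼ y) ⊕ ∼ y      ≈⟨ ∙-congʳ (∼-cong (⇒-contrapositive y x)) ⟨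
    ∼ (∼ y ⊕ x) ⊕ ∼ y          ≈⟨ comm _ _ ⟩
    ∼ y ⊕ ∼ (∼ y ⊕ x)          ∎)

  x·∼x≼𝟘 : ∀ x → x · ∼ x ≼ 𝟘
  x·∼x≼𝟘 x = ≼-reflexive (trans (∼-cong (trans (comm _ _) (∼-complement (∼ x)))) (∼-involutive 𝟘))

  x⇒𝟘 : ∀ x → (x ⇒ 𝟘) ≈ ∼ x
  x⇒𝟘 x = identityʳ (∼ x)

  -- The join unfolds to the inequality `((x ⇒ y) ⇒ (y ⇒ x)) ≼ (y ⇒ x)`. In terms of the complements
  -- `p` and `q` of the two implications it reads `(q ⇒ p) ≼ ∼ q`, and this holds because the meet
  -- of `p` and `q` is `𝟘`.
  prelinear : ∀ x y → (x ⇒ y) ∨ (y ⇒ x) ≈ 𝟙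
  prelinear x y = begin
    ((x ⇒ y) ⇒ (y ⇒ x))  ≈⟨ ∙-cong (∼-cong (a≈∼p x y)) (a≈∼p y x) ⟩
    (∼ p ⇒ ∼ q)          ≈⟨ ⇒-contrapositive q p ⟨
    (q ⇒ p)              ≤⟨ residuate (≼-respˡ (·-comm _ _) disjoint) ⟩
    (q ⇒ 𝟘)              ≈⟨ x⇒𝟘 q ⟩
    ∼ q                  ≈⟨ a≈∼p y x ⟨
    (y ⇒ x)              ∎
    where
    p = x · ∼ y
    q = y · ∼ x
    w = x ⇒ q
    a≈∼p : ∀ x y → (x ⇒ y) ≈ ∼ (x · ∼ y)
    a≈∼p x y = sym (trans (∼-involutive _) (∙-congˡ (∼-involutive y)))
    -- Two uses of divisibility expose `x · w`, which lies below `q = y · ∼ x`. The factor `y`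
    -- together with `w ⇒ ∼ y` then gives `∼ w`, which lies below `∼ ∼ x` and cancels against `∼ x`.
    disjoint : q · (q ⇒ p) ≼ 𝟘
    disjoint = begin
      q · (q ⇒ p)              ≈⟨ ·-divisible q p ⟩
      x · ∼ y · (p ⇒ q)        ≈⟨ ·-cong refl (trans (∙-congʳ (∼-cong (·-comm _ _))) (⇒-curry _ _ _)) ⟩
      x · ∼ y · (∼ y ⇒ w)      ≈⟨ ·-assoc _ _ _ ⟩
      x · (∼ y · (∼ y ⇒ w))    ≈⟨ ·-cong refl (·-divisible (∼ y) w) ⟩
      x · (w · (w ⇒ ∼ y))      ≈⟨ ·-assoc _ _ _ ⟨
      x · w · (w ⇒ ∼ y)        ≤⟨ ·-mono (modus-ponens x q) ≼-refl ⟩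
      y · ∼ x · (w ⇒ ∼ y)      ≈⟨ ·-cong (·-comm _ _) (comm _ _) ⟩
      ∼ x · y · (y ⇒ ∼ w)      ≈⟨ ·-assoc _ _ _ ⟩
      ∼ x · (y · (y ⇒ ∼ w))    ≤⟨ ·-mono ≼-refl (modus-ponens y (∼ w)) ⟩
      ∼ x · ∼ w                ≤⟨ ·-mono ≼-refl (∼-antitone (x≼x⊕y (∼ x) q)) ⟩
      ∼ x · ∼ ∼ x              ≤⟨ x·∼x≼𝟘 (∼ x) ⟩
      𝟘                        ∎

  x≼x∨y : ∀ x y → x ≼ x ∨ y
  x≼x∨y x y = ⇒-swap ≼-refl

  y≼x∨y : ∀ x y → y ≼ x ∨ y
  y≼x∨y x y = weaken _ y

  ∨-least : ∀ {x y z} → x ≼ z → y ≼ z → x ∨ y ≼ z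
  ∨-least {x} {y} {z} x≼z y≼z = begin
    x ∨ y  ≤⟨ ⇒-mono (⇒-mono x≼z ≼-refl) ≼-refl ⟩
    z ∨ y  ≈⟨ łukasiewicz z y ⟩
    y ∨ z  ≈⟨ ≼⇒∨≈ y≼z ⟩
    z      ∎

  ∨-mono : ∀ {x y u v} → x ≼ y → u ≼ v → x ∨ u ≼ y ∨ v
  ∨-mono x≼y u≼v = ∨-least (≼-trans x≼y (x≼x∨y _ _)) (≼-trans u≼v (y≼x∨y _ _))

  𝟘∨x≼x : ∀ {x} → 𝟘 ∨ x ≼ x
  𝟘∨x≼x = ∨-least 𝟘≼ ≼-refl

  -- This makes the elements whose join with a fixed `z` lies in a filter closed under products.
  -- After residuation both joins are eliminated by cases; wherever `z` is a factor, the product is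
  -- below `z`.
  ·-∨-subdistrib : ∀ x y z → (x ∨ z) · (y ∨ z) ≼ x · y ∨ z
  ·-∨-subdistrib x y z = unresiduate (∨-least
    (⇒-swap (∨-least (⇒-swap (residuate (x≼x∨y _ _))) (≼-trans (y≼x∨y _ _) (weaken x _))))
    (≼-trans (y≼x∨y _ _) (weaken (y ∨ z) _)))

  𝟙·𝟙 : 𝟙 · 𝟙 ≈ 𝟙
  𝟙·𝟙 = ∼-cong (trans (∙-congˡ (∼-involutive 𝟘)) (trans (identityʳ _) (∼-involutive 𝟘)))

  ∨-≈𝟙-mono : ∀ {x y u v} → x ≼ y → u ≼ v → x ∨ u ≈ 𝟙 → y ∨ v ≈ 𝟙
  ∨-≈𝟙-mono x≼y u≼v eq = 𝟙≼⇒≈𝟙 (≼-respˡ eq (∨-mono x≼y u≼v))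

  ∨-≈𝟙-· : ∀ {x y z} → x ∨ z ≈ 𝟙 → y ∨ z ≈ 𝟙 → x · y ∨ z ≈ 𝟙
  ∨-≈𝟙-· {x} {y} {z} p q = 𝟙≼⇒≈𝟙 (≼-respˡ (trans (·-cong p q) 𝟙·𝟙) (·-∨-subdistrib x y z))

  -- Monotonicity of `⊕` in a form that applies to implications in a filter. As `x ⊕ z` is
  -- `∼ z ⇒ x`, it is an instance of `⇒-trans`.
  ⇒-⊕-monoˡ : ∀ x y z → (x ⇒ y) ≼ (x ⊕ z ⇒ y ⊕ z)
  ⇒-⊕-monoˡ x y z = residuate (begin
    (x ⇒ y) · (x ⊕ z)    ≈⟨ ·-comm _ _ ⟩
    (x ⊕ z) · (x ⇒ y)    ≈⟨ ·-cong (⊕-as-⇒ x) refl ⟩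
    (∼ z ⇒ x) · (x ⇒ y)  ≤⟨ ⇒-trans (∼ z) x y ⟩
    (∼ z ⇒ y)            ≈⟨ ⊕-as-⇒ y ⟨
    y ⊕ z                ∎)
    where
    ⊕-as-⇒ : ∀ x → x ⊕ z ≈ (∼ z ⇒ x)
    ⊕-as-⇒ x = trans (comm x z) (∙-congʳ (sym (∼-involutive z)))

  ⇒-⊕-monoʳ : ∀ x y z → (x ⇒ y) ≼ (z ⊕ x ⇒ z ⊕ y)
  ⇒-⊕-monoʳ x y z = ≼-respʳ (∙-cong (∼-cong (comm x z)) (comm y z)) (⇒-⊕-monoˡ x y z)

-- Filters of an MV-algebra.

module FilterProperties (M : MVAlgebra c ℓ) {r} {F : Pred (MVAlgebra.Carrier M) r} (isFilter : IsFilter M F) where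
  open MVAlgebra M
  open MVProperties M
  open IsFilter isFilter

  ≈𝟙⇒∈ : ∀ {x} → x ≈ 𝟙 → x ∈ F
  ≈𝟙⇒∈ x≈𝟙 = upward (proj₂ nonempty) (≼-respʳ (sym x≈𝟙) ≼𝟙)

  ≼⇒∈ : ∀ {x y} → x ≼ y → (x ⇒ y) ∈ F
  ≼⇒∈ = ≈𝟙⇒∈

  ∈-resp : ∀ {x y} → x ≈ y → x ∈ F → y ∈ F
  ∈-resp x≈y x∈ = upward x∈ (≼-reflexive x≈y)

  ⇒-trans-∈ : ∀ {x y z} → (x ⇒ y) ∈ F → (y ⇒ z) ∈ F → (x ⇒ z) ∈ F
  ⇒-trans-∈ p q = upward (·-closed p q) (⇒-trans _ _ _)

  𝟘∉ : Proper M F → 𝟘 ∉ F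
  𝟘∉ proper 𝟘∈F = proper λ x → upward 𝟘∈F 𝟘≼

-- Maximal filters: their existence and the linear order of their quotients.

module Extension (em : ∀ {ℓ} → ExcludedMiddle ℓ) where
  open Classical em

  -- Filters given by unions or existential conditions need not live in the universe that
  -- `MaximalFilter` fixes. Excluded middle replaces such a condition by the outcome of its
  -- decision, which fits at any level.
  Resize : ∀ {a} b → Set a → Set b
  Resize b P = Lift b (True (em {P = P}))

  resize : ∀ {a b} {P : Set a} → P → Resize b P
  resize p = lift (fromWitness p)

  unresize : ∀ {a b} {P : Set a} → Resize b P → P
  unresize (lift p) = toWitness p

  module _ (M : MVAlgebra c ℓ) where
    open MVAlgebra M
    open MVProperties M

    -- Zorn's lemma for the proper filters that contain `H`, ordered by inclusion; chains are
    -- bounded by their unions.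
    extend-to-maximal : (∀ {c ℓ₁ ℓ₂ p} → Zorn c ℓ₁ ℓ₂ p) → {H : Pred Carrier (c ⊔ ℓ)} →
      IsFilter M H → Proper M H → ∃ λ (F : MaximalFilter M) → H ⊆ MaximalFilter.member F
    extend-to-maximal zorn {H} H-filter H-proper =
      let ((F , F-filter , F-proper , H⊆F) , F-max) = zorn {p = 0ℓ} poset chain-bound
      in record
        { member   = F
        ; isFilter = F-filter
        ; proper   = F-proper
        ; maximal  = λ {G} G-filter G-proper F⊆G →
            F-max {G , G-filter , G-proper , λ {x} x∈H → F⊆G (H⊆F {x} x∈H)} F⊆G
        } , λ {x} → H⊆F {x}
      where
      ProperExtension : Set _
      ProperExtension = ∃ λ (G : Pred Carrier (c ⊔ ℓ)) → IsFilter M G × Proper M G × (∀ {x} → x ∈ H → x ∈ G)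

      poset : Poset _ _ _
      poset = record
        { Carrier = ProperExtension
        ; _≈_ = λ P Q → proj₁ P ≐ proj₁ Q
        ; _≤_ = λ P Q → proj₁ P ⊆ proj₁ Q
        ; isPartialOrder = record
          { isPreorder = record
            { isEquivalence = record
              { refl  = id , id
              ; sym   = swap
              ; trans = λ (p , p′) (q , q′) → q ∘ p , p′ ∘ q′
              }
            ; reflexive = proj₁
            ; trans     = λ p q → q ∘ p
            }
          ; antisym = _,_
          }
        }

      base : ProperExtension
      base = H , H-filter , H-proper , id

      chain-bound : (C : Pred ProperExtension 0ℓ) →
        (∀ {P Q} → P ∈ C → Q ∈ C → proj₁ P ⊆ proj₁ Q ⊎ proj₁ Q ⊆ proj₁ P) →
        ∃ λ U → ∀ {P} → P ∈ C → proj₁ P ⊆ proj₁ U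
      chain-bound C chain = (U , U-filter , U-proper , λ {_} x∈H → resize (base , inj₁ ≡.refl , x∈H)) ,
          λ {P} P∈C x∈P → resize (P , inj₂ P∈C , x∈P)
        where
        -- `H` itself is adjoined so that even the empty chain has a filter as its union. As `H` is
        -- contained in every other member, the result is again a chain.
        C₀ : Pred ProperExtension _
        C₀ P = P ≡ base ⊎ P ∈ C

        U : Pred Carrier (c ⊔ ℓ)
        U x = Resize (c ⊔ ℓ) (∃ λ P → P ∈ C₀ × x ∈ proj₁ P)

        chain₀ : ∀ {P Q} → P ∈ C₀ → Q ∈ C₀ → proj₁ P ⊆ proj₁ Q ⊎ proj₁ Q ⊆ proj₁ P
        chain₀ {Q = _ , _ , _ , H⊆Q} (inj₁ ≡.refl) _ = inj₁ H⊆Q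
        chain₀ {_ , _ , _ , H⊆P} (inj₂ _) (inj₁ ≡.refl) = inj₂ H⊆P
        chain₀ (inj₂ P∈C) (inj₂ Q∈C) = chain P∈C Q∈C

        U-·-closed : ∀ {x y} → x ∈ U → y ∈ U → x · y ∈ U
        U-·-closed x∈U y∈U with unresize x∈U | unresize y∈U
        ... | P , P∈ , x∈P | Q , Q∈ , y∈Q with chain₀ P∈ Q∈
        ... | inj₁ P⊆Q = resize (Q , Q∈ , IsFilter.·-closed (proj₁ (proj₂ Q)) (P⊆Q x∈P) y∈Q)
        ... | inj₂ Q⊆P = resize (P , P∈ , IsFilter.·-closed (proj₁ (proj₂ P)) x∈P (Q⊆P y∈Q))

        U-filter : IsFilter M U
        U-filter = record
          { nonempty = let (x , x∈H) = IsFilter.nonempty H-filter in x , resize (base , inj₁ ≡.refl , x∈H)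
          ; upward   = λ x∈U x≼y → let (P , P∈ , x∈P) = unresize x∈U in
              resize (P , P∈ , IsFilter.upward (proj₁ (proj₂ P)) x∈P x≼y)
          ; ·-closed = U-·-closed
          }

        -- A filter is proper as soon as it omits `𝟘`, a condition that unions preserve.
        U-proper : Proper M U
        U-proper all∈U = let ((_ , P-filter , P-proper , _) , _ , 𝟘∈P) = unresize (all∈U 𝟘) in
          FilterProperties.𝟘∉ M P-filter P-proper 𝟘∈P

    module MaximalFilterProperties (F : MaximalFilter M) where
      open MaximalFilter F
      open IsFilter isFilter
      open FilterProperties M isFilter

      -- If `y ⇒ x` is outside the filter, the `z` with `z ∨ (y ⇒ x)` inside form a proper filter
      -- that contains it. By maximality the two coincide, and prelinearity puts `x ⇒ y` there.
      total : ∀ x y → (x ⇒ y) ∈ member ⊎ (y ⇒ x) ∈ member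
      total x y with em {P = (y ⇒ x) ∈ member}
      ... | yes y⇒x∈F = inj₂ y⇒x∈F
      ... | no  y⇒x∉F = inj₁ (maximal {G} G-filter
              (λ all∈G → y⇒x∉F (upward (all∈G 𝟘) 𝟘∨x≼x))
              (λ z∈F → upward z∈F (x≼x∨y _ _))
              (≈𝟙⇒∈ (prelinear x y)))
        where
        G : Pred Carrier _
        G z = z ∨ (y ⇒ x) ∈ member

        G-filter : IsFilter M G
        G-filter = record
          { nonempty = 𝟙 , upward (≈𝟙⇒∈ refl) (x≼x∨y _ _)
          ; upward   = λ z∈G z≼w → upward z∈G (∨-mono z≼w ≼-refl)
          ; ·-closed = λ z∈G w∈G → upward (·-closed z∈G w∈G) (·-∨-subdistrib _ _ _)
          }

-- Truncated arithmetic of rationals in the unit interval.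

∁ : ℚ[0,1] → ℚ[0,1]
∁ (r , 0≤r , r≤1) = 1ℚ - r ,
  shift-≤ {0ℚ} {1ℚ - r} r≤1 (solve 2 (λ o r → con 0ℚ :+ o := o :- r :+ r) ≡.refl 1ℚ r) ,
  shift-≤ {1ℚ - r} {1ℚ} 0≤r (solve 2 (λ o r → o :- r :+ r := o :+ con 0ℚ) ≡.refl 1ℚ r)

infixl 6 _⊞_
_⊞_ : ℚ[0,1] → ℚ[0,1] → ℚ[0,1]
(r , 0≤r , r≤1) ⊞ (s , 0≤s , s≤1) = (r + s) ⊓ 1ℚ ,
  ⊓-glb (+-mono-≤ 0≤r 0≤s) (proj₂ (proj₂ 0ᴵ)) ,
  p⊓q≤q (r + s) 1ℚ

s-d≤s : ∀ s {d} → 0ℚ ≤ d → s - d ≤ s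
s-d≤s s {d} 0≤d = shift-≤ {s - d} {s} 0≤d (solve 2 (λ s d → s :- d :+ d := s :+ con 0ℚ) ≡.refl s d)

infixl 6 _⊟_
_⊟_ : ℚ[0,1] → ℚ[0,1] → ℚ[0,1]
(r , 0≤r , r≤1) ⊟ (s , 0≤s , s≤1) = (r - s) ⊔ℚ 0ℚ ,
  p≤q⊔p (r - s) 0ℚ ,
  ⊔-lub (≤-trans (s-d≤s r 0≤s) r≤1) (proj₂ (proj₂ 0ᴵ))

⊓-glb-< : ∀ {p a b} → p < a → p < b → p < a ⊓ b
⊓-glb-< {p} {a} {b} p<a p<b with ⊓-sel a b
... | inj₁ eq = ≡.subst (p <_) (≡.sym eq) p<a
... | inj₂ eq = ≡.subst (p <_) (≡.sym eq) p<b

0≤·ℕ : ∀ n {ε} → 0ℚ ≤ ε → 0ℚ ≤ n ·ℕ ε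
0≤·ℕ zero    0≤ε = ≤-refl
0≤·ℕ (suc n) 0≤ε = +-mono-≤ 0≤ε (0≤·ℕ n 0≤ε)

<-minus-comm : ∀ {s w d} → w < s - d → d < s - w
<-minus-comm {s} {w} {d} w<s-d = shift-< {d} {s - w} w<s-d
  (solve 3 (λ s w d → d :+ (s :- d) := s :- w :+ w) ≡.refl s w d)

-- Constants of a Pavelka algebra and their membership in proper filters.

module PavelkaProperties (A : PavelkaAlgebra c ℓ) where
  open PavelkaAlgebra A using (mvAlgebra; const; const-⊕; const-∼)
  open MVAlgebra mvAlgebra
  open MVProperties mvAlgebra

  const-∁ : ∀ r → ∼ const r ≈ const (∁ r)
  const-∁ r = const-∼ {r} {∁ r} ≡.refl

  const-1 : const 1ᴵ ≈ 𝟙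
  const-1 = sym (const-∼ {0ᴵ} {1ᴵ} ≡.refl)

  const-⊞ : ∀ r s → const r ⊕ const s ≈ const (r ⊞ s)
  const-⊞ r s = const-⊕ {r} {s} {r ⊞ s} ≡.refl

  const-⇒ : ∀ r s t → (1ℚ - proj₁ r + proj₁ s) ⊓ 1ℚ ≡ proj₁ t → (const r ⇒ const s) ≈ const t
  const-⇒ r s t eq = trans (∙-congʳ (const-∁ r)) (const-⊕ {∁ r} {s} {t} eq)

  const-mono : ∀ r s → proj₁ r ≤ proj₁ s → const r ≼ const s
  const-mono r s r≤s = trans (const-⇒ r s 1ᴵ (p≥q⇒p⊓q≡q (shift-≤ {1ℚ} {1ℚ - proj₁ r + proj₁ s} r≤s
    (solve 3 (λ o r s → o :+ s := o :- r :+ s :+ r) ≡.refl 1ℚ (proj₁ r) (proj₁ s))))) const-1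

  -- `r ⊟ ∁ s` is max (r + s - 1) 0, the Łukasiewicz product of the two rationals.
  const-·-⊟ : ∀ r s → const r · const s ≼ const (r ⊟ ∁ s)
  const-·-⊟ r s = unresiduate (≼-respʳ (sym (const-⇒ s (r ⊟ ∁ s) (∁ s ⊞ (r ⊟ ∁ s)) ≡.refl))
    (const-mono r (∁ s ⊞ (r ⊟ ∁ s)) (⊓-glb
      (≤-trans (≤-reflexive (p≡q+[p-q] (proj₁ r) (proj₁ (∁ s)))) (+-monoʳ-≤ (proj₁ (∁ s)) (p≤p⊔q _ 0ℚ)))
      (proj₂ (proj₂ r)))))

  const-⇒-⊟ : ∀ s w → (const s ⇒ const w) ≼ ∼ const (s ⊟ w)
  const-⇒-⊟ s w = ≼-respˡ (sym (const-⇒ s w (∁ s ⊞ w) ≡.refl)) (≼-respʳ (sym (const-∁ (s ⊟ w)))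
    (const-mono (∁ s ⊞ w) (∁ (s ⊟ w)) value))
    where
    value : (1ℚ - proj₁ s + proj₁ w) ⊓ 1ℚ ≤ 1ℚ - ((proj₁ s - proj₁ w) ⊔ℚ 0ℚ)
    value with ⊔-sel (proj₁ s - proj₁ w) 0ℚ
    ... | inj₁ eq = ≡.subst (λ m → (1ℚ - proj₁ s + proj₁ w) ⊓ 1ℚ ≤ 1ℚ - m) (≡.sym eq)
      (≤-trans (p⊓q≤p (1ℚ - proj₁ s + proj₁ w) 1ℚ) (≤-reflexive
        (solve 3 (λ o s w → o :- s :+ w := o :- (s :- w)) ≡.refl 1ℚ (proj₁ s) (proj₁ w))))
    ... | inj₂ eq = ≡.subst (λ m → (1ℚ - proj₁ s + proj₁ w) ⊓ 1ℚ ≤ 1ℚ - m) (≡.sym eq) (p⊓q≤q (1ℚ - proj₁ s + proj₁ w) 1ℚ)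

  module ProperFilter {p} {F : Pred Carrier p} (isFilter : IsFilter mvAlgebra F) (proper : Proper mvAlgebra F) where
    open IsFilter isFilter
    open FilterProperties mvAlgebra isFilter

    -- Each multiplication by `q` lowers a constant by `ε`, that is 1 - q, until it reaches 0. If q
    -- < 1, then by the Archimedean property finitely many factors bring `𝟙` down to `𝟘`, which a
    -- proper filter excludes.
    const∈⇒1≤ : ∀ q → const q ∈ F → 1ℚ ≤ proj₁ q
    const∈⇒1≤ q q∈F = ≮⇒≥ λ q<1 →
      let (n , 1≤nε) = archimedean (0<diff q<1) in go n 1ᴵ (≈𝟙⇒∈ const-1) 1≤nε
      where
      ε = 1ℚ - proj₁ q
      go : ∀ n r → const r ∈ F → proj₁ r ≤ n ·ℕ ε → ⊥
      go zero    r r∈F r≤0  = 𝟘∉ proper (upward r∈F (const-mono r 0ᴵ r≤0))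
      go (suc n) r r∈F r≤ = go n (r ⊟ ∁ q) (upward (·-closed r∈F q∈F) (const-·-⊟ r q))
        (⊔-lub (shift-≤ {proj₁ r - ε} {n ·ℕ ε} r≤ (solve 3 (λ r ε m → r :- ε :+ (ε :+ m) := m :+ r) ≡.refl (proj₁ r) ε (n ·ℕ ε)))
               (0≤·ℕ n (proj₁ (proj₂ (∁ q)))))

    const-⇒∈⇒≤ : ∀ r s → (const r ⇒ const s) ∈ F → proj₁ r ≤ proj₁ s
    const-⇒∈⇒≤ r s r⇒s∈F = shift-≤
      (≤-trans (const∈⇒1≤ (∁ r ⊞ s) (∈-resp (const-⇒ r s (∁ r ⊞ s) ≡.refl) r⇒s∈F)) (p⊓q≤p _ 1ℚ))
      (solve 3 (λ o r s → r :+ (o :- r :+ s) := s :+ o) ≡.refl 1ℚ (proj₁ r) (proj₁ s))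

-- The embedding of the quotient by a maximal filter into the unit interval.

module [0,1]Properties (em : ∀ {ℓ} → ExcludedMiddle ℓ) where
  open Classical em
  open MVAlgebra (PavelkaAlgebra.mvAlgebra [0,1])

  1⊆⇒≈𝟙 : ∀ x → (∀ {p} → p < 1ℚ → p ∈ lower x) → x ≈ 𝟙
  1⊆⇒≈𝟙 x 1⊆x = (λ p∈x → proj₂ ∼ᴵ0≈1 (bounded x p∈x)) , λ p∈𝟙 → 1⊆x (proj₁ ∼ᴵ0≈1 p∈𝟙)

  ≈𝟙⇒1⊆ : ∀ x → x ≈ 𝟙 → ∀ {p} → p < 1ℚ → p ∈ lower x
  ≈𝟙⇒1⊆ x (_ , 𝟙⊆x) p<1 = 𝟙⊆x (proj₂ ∼ᴵ0≈1 p<1)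

  0≉1 : ¬ (constᴵ 0ᴵ ≈ 𝟙)
  0≉1 0≈1 = <-irrefl ≡.refl (≈𝟙⇒1⊆ (constᴵ 0ᴵ) 0≈1 (positive⁻¹ 1ℚ))

module Embedding (em : ∀ {ℓ} → ExcludedMiddle ℓ) (A : PavelkaAlgebra c ℓ) (F : SpecM A) where
  open Classical em
  open Extension em
  open [0,1]Properties em
  open PavelkaAlgebra A using (mvAlgebra; const)
  open MVAlgebra mvAlgebra
  open MVProperties mvAlgebra
  open PavelkaProperties A
  open MaximalFilter F
  open IsFilter isFilter
  open FilterProperties mvAlgebra isFilter
  open ProperFilter isFilter proper
  open MaximalFilterProperties mvAlgebra F
  private
    module I = MVAlgebra (PavelkaAlgebra.mvAlgebra [0,1])
    module IP = MVProperties (PavelkaAlgebra.mvAlgebra [0,1])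

  Below : Carrier → ℚ → Set _
  Below x p = ∃ λ r → p < proj₁ r × (const r ⇒ x) ∈ member

  -- The strict `p < r` in `Below` makes the cut rounded, and `True em` brings membership down to
  -- `Set`.
  embed : Carrier → 𝕀
  embed x = record
    { lower   = λ p → True (em {P = Below x p})
    ; neg     = λ p<0 → fromWitness (0ᴵ , p<0 , ≼⇒∈ 𝟘≼)
    ; bounded = λ p∈ → let ((_ , _ , r≤1) , p<r , _) = toWitness p∈ in <-≤-trans p<r r≤1
    ; down    = λ p≤q q∈ → let (r , q<r , r⇒x) = toWitness q∈ in fromWitness (r , ≤-<-trans p≤q q<r , r⇒x)
    ; rounded = λ p∈ → let (r , p<r , r⇒x) = toWitness p∈
                           (q , p<q , q<r) = <-dense p<r
                       in q , p<q , fromWitness (r , q<r , r⇒x)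
    }

  embed-∈ : ∀ {x p} r → p < proj₁ r → (const r ⇒ x) ∈ member → p ∈ lower (embed x)
  embed-∈ r p<r r⇒x = fromWitness (r , p<r , r⇒x)

  embed-< : ∀ {x p} s → (x ⇒ const s) ∈ member → p ∈ lower (embed x) → p < proj₁ s
  embed-< s x⇒s p∈ = let (r , p<r , r⇒x) = toWitness p∈ in
    <-≤-trans p<r (const-⇒∈⇒≤ r s (⇒-trans-∈ r⇒x x⇒s))

  -- The linear order of the quotient enters here: a constant that is not a lower bound of `x` must
  -- be an upper bound.
  embed-∉ : ∀ {x p} r → p ∉ lower (embed x) → p < proj₁ r → (x ⇒ const r) ∈ member
  embed-∉ {x} r p∉ p<r with total x (const r)
  ... | inj₁ x⇒r = x⇒r
  ... | inj₂ r⇒x = ⊥-elim (p∉ (embed-∈ r p<r r⇒x))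

  embed-mono : ∀ {x y} → (x ⇒ y) ∈ member → lower (embed x) ⊆ lower (embed y)
  embed-mono x⇒y p∈ = let (r , p<r , r⇒x) = toWitness p∈ in embed-∈ r p<r (⇒-trans-∈ r⇒x x⇒y)

  embed-const : ∀ r → embed (const r) ≈ᴵ constᴵ r
  embed-const r = embed-< r (≼⇒∈ ≼-refl) , λ p<r → embed-∈ r p<r (≼⇒∈ ≼-refl)

  embed-∼ : ∀ x → embed (∼ x) ≈ᴵ ∼ᴵ embed x
  embed-∼ x = to , from
    where
    to : lower (embed (∼ x)) ⊆ lower (∼ᴵ embed x)
    to {p} p∈ = let (r , p<r , r⇒∼x) = toWitness p∈ in
      -- As `r` is a lower bound of `∼ x`, its complement is an upper bound of `x` and so lies
      -- outside the open cut of `x`.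
      1ℚ - proj₁ r ,
      (λ q∈ → <-irrefl ≡.refl (embed-< (∁ r) (∈-resp (trans (comm _ _) (∙-congˡ (const-∁ r))) r⇒∼x) q∈)) ,
      ≡.subst (p <_) (solve 2 (λ o r → r := o :- (o :- r)) ≡.refl 1ℚ (proj₁ r)) p<r
    from : lower (∼ᴵ embed x) ⊆ lower (embed (∼ x))
    from {p} (q , q∉ , p<1-q) with p <? 0ℚ
    ... | yes p<0 = neg (embed (∼ x)) p<0
    ... | no  p≮0 =
      -- Any `r` between `p` and `1 - q` satisfies `q < 1 - r`, so `∁ r` is an upper bound of `x`
      -- and, by contraposition, `r` is a lower bound of `∼ x`.
      let (r , p<r , r<1-q) = <-dense p<1-q
          q<1-r = shift-< {q} {1ℚ - r} r<1-q (solve 3 (λ o q r → q :+ (o :- q) := o :- r :+ r) ≡.refl 1ℚ q r)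
          0≤q   = ≮⇒≥ λ q<0 → q∉ (neg (embed x) q<0)
          r≤1   = shift-≤ {r} {1ℚ} (≤-trans 0≤q (<⇒≤ q<1-r)) (solve 2 (λ o r → r :+ (o :- r) := o :+ con 0ℚ) ≡.refl 1ℚ r)
          rᴵ    = r , ≤-trans (≮⇒≥ p≮0) (<⇒≤ p<r) , r≤1
      in embed-∈ rᴵ p<r (∈-resp (trans (∙-congˡ (sym (const-∁ rᴵ))) (comm _ _)) (embed-∉ (∁ rᴵ) q∉ q<1-r))

  embed-⊕ : ∀ x y → embed (x ⊕ y) ≈ᴵ embed x ⊕ᴵ embed y
  embed-⊕ x y = to , from
    where
    from : lower (embed x ⊕ᴵ embed y) ⊆ lower (embed (x ⊕ y))
    from {p} (p<1 , q , r , q∈ , r∈ , p≤q+r) =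
      let (a , q<a , a⇒x) = toWitness q∈
          (b , r<b , b⇒y) = toWitness r∈
      in embed-∈ (a ⊞ b) (⊓-glb-< (≤-<-trans p≤q+r (+-mono-< q<a r<b)) p<1)
           (⇒-trans-∈ (≼⇒∈ (≼-reflexive (sym (const-⊞ a b))))
             (⇒-trans-∈ (upward a⇒x (⇒-⊕-monoˡ _ _ _)) (upward b⇒y (⇒-⊕-monoʳ _ _ _))))
    -- Split `p` as `q + (p - q)`, where `q` is in the cut of `x` and `q + ε` is not. A constant `w`
    -- slightly above `q + ε` is an upper bound of `x`, so `s ⊟ w` is a lower bound of `y`; the
    -- choice of `ε` below `s - p` leaves room for `s - w` to exceed `p - q`.
    to : lower (embed (x ⊕ y)) ⊆ lower (embed x ⊕ᴵ embed y)
    to {p} p∈ =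
      let (s , p<s , s⇒x⊕y) = toWitness p∈
          (ε , 0<ε , ε<s-p) = <-dense (0<diff p<s)
          (q , q∈ , q+ε∉)   = locate (embed x) 0<ε
      in bounded (embed (x ⊕ y)) p∈ , q , p - q , q∈ , rest s s⇒x⊕y q q+ε∉
           (shift-< ε<s-p (solve 4 (λ p q ε s → q :+ ε :+ (s :- p) := s :- (p :- q) :+ ε) ≡.refl p q ε (proj₁ s))) ,
         ≤-q+[p-q] p q
      where
      remainder : ∀ {d} s w → (const s ⇒ x ⊕ y) ∈ member → (x ⇒ const w) ∈ member → d < proj₁ s - proj₁ w →
        d ∈ lower (embed y)
      remainder s w s⇒x⊕y x⇒w d<s-w = embed-∈ (s ⊟ w) (<-≤-trans d<s-w (p≤p⊔q _ 0ℚ))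
        (upward (∈-resp (sym (assoc _ _ _)) (⇒-trans-∈ s⇒x⊕y (upward x⇒w (⇒-⊕-monoˡ _ _ _))))
          (⊕-monoˡ y (const-⇒-⊟ s w)))
      rest : ∀ s → (const s ⇒ x ⊕ y) ∈ member → ∀ q {q′} → q′ ∉ lower (embed x) → q′ < proj₁ s - (p - q) →
        p - q ∈ lower (embed y)
      rest s s⇒x⊕y q {q′} q′∉ q′< with p - q <? 0ℚ
      ... | yes p-q<0 = neg (embed y) p-q<0
      ... | no  p-q≮0 =
        -- Nonnegativity of `p - q` keeps `w` at most 1, so that `w` names a constant.
        let (w , q′<w , w<) = <-dense q′<
            0≤w = ≤-trans (≮⇒≥ λ q′<0 → q′∉ (neg (embed x) q′<0)) (<⇒≤ q′<w)
            w≤1 = ≤-trans (≤-trans (<⇒≤ w<) (s-d≤s (proj₁ s) (≮⇒≥ p-q≮0))) (proj₂ (proj₂ s))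
        in remainder s (w , 0≤w , w≤1) s⇒x⊕y (embed-∉ (w , 0≤w , w≤1) q′∉ q′<w) (<-minus-comm {proj₁ s} w<)

  embed-isHomomorphism : IsPavelkaHomomorphism A [0,1] embed
  embed-isHomomorphism = record
    { isMVHomomorphism = record
      { f-cong = λ x≈y → embed-mono (≼⇒∈ (≼-reflexive x≈y)) , embed-mono (≼⇒∈ (≼-reflexive (sym x≈y)))
      ; ⊕-homo = embed-⊕
      ; ∼-homo = embed-∼
      ; 𝟘-homo = embed-const 0ᴵ
      }
    ; const-homo = embed-const
    }

  -- The preimage of 1 is a proper filter that contains `member`, so maximality makes them equal.
  -- This is what makes `embed` injective on the quotient.
  embed-𝟙⇒∈ : ∀ {z} → embed z ≈ᴵ I.𝟙 → z ∈ member
  embed-𝟙⇒∈ z≈𝟙 = maximal {G} G-filter G-proper F⊆G (lift z≈𝟙)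
    where
    G : Pred Carrier _
    G z = Lift _ (embed z ≈ᴵ I.𝟙)

    F⊆G : member ⊆ G
    F⊆G {z} z∈F = lift (1⊆⇒≈𝟙 (embed z) λ p<1 →
      embed-∈ 1ᴵ p<1 (∈-resp (trans (sym (𝟙⇒ z)) (∙-congʳ (∼-cong (sym const-1)))) z∈F))

    embed-· : ∀ z w → embed (z · w) ≈ᴵ embed z I.· embed w
    embed-· z w = begin
      embed (z · w)                      ≈⟨ embed-∼ (∼ z ⊕ ∼ w) ⟩
      ∼ᴵ embed (∼ z ⊕ ∼ w)               ≈⟨ I.∼-cong {embed (∼ z ⊕ ∼ w)} {embed (∼ z) ⊕ᴵ embed (∼ w)} (embed-⊕ (∼ z) (∼ w)) ⟩
      ∼ᴵ (embed (∼ z) ⊕ᴵ embed (∼ w))    ≈⟨ I.∼-cong {embed (∼ z) ⊕ᴵ embed (∼ w)} {∼ᴵ embed z ⊕ᴵ ∼ᴵ embed w}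
        (I.∙-cong {embed (∼ z)} {∼ᴵ embed z} {embed (∼ w)} {∼ᴵ embed w} (embed-∼ z) (embed-∼ w)) ⟩
      embed z I.· embed w                ∎
      where open ≈-Reasoning I.setoid

    G-filter : IsFilter mvAlgebra G
    G-filter = record
      { nonempty = 𝟙 , F⊆G (≈𝟙⇒∈ refl)
      ; upward   = λ {z} {w} (lift z≈𝟙) z≼w →
          lift (1⊆⇒≈𝟙 (embed w) (embed-mono (≼⇒∈ z≼w) ∘ ≈𝟙⇒1⊆ (embed z) z≈𝟙))
      ; ·-closed = λ {z} {w} (lift z≈𝟙) (lift w≈𝟙) →
          lift (I.trans {embed (z · w)} {embed z I.· embed w} {I.𝟙} (embed-· z w)
            (I.trans {embed z I.· embed w} {I.𝟙 I.· I.𝟙} {I.𝟙} (IP.·-cong {embed z} {I.𝟙} {embed w} {I.𝟙} z≈𝟙 w≈𝟙) IP.𝟙·𝟙))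
      }

    G-proper : Proper mvAlgebra G
    G-proper all∈G = 0≉1 (I.trans {constᴵ 0ᴵ} {embed 𝟘} {I.𝟙} (swap (embed-const 0ᴵ)) (Lift.lower (all∈G 𝟘)))

  quotientEmbedding : QuotientEmbedding A F
  quotientEmbedding = record
    { embed          = embed
    ; isHomomorphism = embed-isHomomorphism
    ; kernel         = λ x y → mk⇔
        (λ (x⇒y , y⇒x) → embed-mono x⇒y , embed-mono y⇒x)
        (λ (x⊆y , y⊆x) → embed-⊆⇒∈ x y x⊆y , embed-⊆⇒∈ y x y⊆x)
    }
    where
    embed-⊆⇒∈ : ∀ x y → lower (embed x) ⊆ lower (embed y) → (x ⇒ y) ∈ member
    embed-⊆⇒∈ x y x⊆y = embed-𝟙⇒∈ (begin
      embed (x ⇒ y)            ≈⟨ embed-⊕ (∼ x) y ⟩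
      embed (∼ x) ⊕ᴵ embed y   ≈⟨ I.∙-congʳ {embed y} {embed (∼ x)} {∼ᴵ embed x} (embed-∼ x) ⟩
      (embed x ⇒ᴵ embed y)     ≈⟨ ⊆⇒≼ᴵ (embed x) (embed y) x⊆y ⟩
      I.𝟙                      ∎)
      where open ≈-Reasoning I.setoid

-- The real value x/F and its link with membership in F.

module Quotient (em : ∀ {ℓ} → ExcludedMiddle ℓ) (A : PavelkaAlgebra c ℓ) (F : SpecM A) where
  open Classical em
  open PavelkaAlgebra A using (mvAlgebra; const)
  open MVAlgebra mvAlgebra
  open MVProperties mvAlgebra
  open MaximalFilter F
  open FilterProperties mvAlgebra isFilter
  private
    module I = MVAlgebra (PavelkaAlgebra.mvAlgebra [0,1])
    module IP = MVProperties (PavelkaAlgebra.mvAlgebra [0,1])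

  ⟦_⟧ : Carrier → 𝕀
  ⟦ x ⟧ = quotient A x F

  -- The constructed embedding rules out the default branch of `quotient`. Stating this as an
  -- equation of functions lets every property of the chosen embedding be transported to `⟦_⟧`.
  ⟦⟧-embedding : ∃ λ (e : QuotientEmbedding A F) → QuotientEmbedding.embed e ≡ ⟦_⟧
  ⟦⟧-embedding with em {P = QuotientEmbedding A F}
  ... | yes e  = e , ≡.refl
  ... | no  ¬e = ⊥-elim (¬e (Embedding.quotientEmbedding em A F))

  ⟦⟧-isHomomorphism : IsPavelkaHomomorphism A [0,1] ⟦_⟧
  ⟦⟧-isHomomorphism = let (e , eq) = ⟦⟧-embedding in
    ≡.subst (IsPavelkaHomomorphism A [0,1]) eq (QuotientEmbedding.isHomomorphism e)

  ⟦⟧-kernel : ∀ x y → ((x ⇒ y) ∈ member × (y ⇒ x) ∈ member) ⇔ ⟦ x ⟧ ≈ᴵ ⟦ y ⟧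
  ⟦⟧-kernel = let (e , eq) = ⟦⟧-embedding in
    ≡.subst (λ f → ∀ x y → ((x ⇒ y) ∈ member × (y ⇒ x) ∈ member) ⇔ f x ≈ᴵ f y) eq (QuotientEmbedding.kernel e)

  open IsPavelkaHomomorphism ⟦⟧-isHomomorphism public using (isMVHomomorphism; const-homo)
  open IsMVHomomorphism isMVHomomorphism

  ⟦⟧-⇒ : ∀ x y → ⟦ x ⇒ y ⟧ ≈ᴵ (⟦ x ⟧ ⇒ᴵ ⟦ y ⟧)
  ⟦⟧-⇒ x y = I.trans {⟦ x ⇒ y ⟧} {⟦ ∼ x ⟧ ⊕ᴵ ⟦ y ⟧} {⟦ x ⟧ ⇒ᴵ ⟦ y ⟧} (⊕-homo (∼ x) y) (I.∙-congʳ {⟦ y ⟧} {⟦ ∼ x ⟧} {∼ᴵ ⟦ x ⟧} (∼-homo x))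

  ⟦⟧-𝟙 : ⟦ 𝟙 ⟧ ≈ᴵ I.𝟙
  ⟦⟧-𝟙 = I.trans {⟦ 𝟙 ⟧} {∼ᴵ ⟦ 𝟘 ⟧} {I.𝟙} (∼-homo 𝟘) (I.∼-cong {⟦ 𝟘 ⟧} {I.𝟘} 𝟘-homo)

  ∈⇒⟦⟧≈𝟙 : ∀ {x} → x ∈ member → ⟦ x ⟧ ≈ᴵ I.𝟙
  ∈⇒⟦⟧≈𝟙 {x} x∈F = I.trans {⟦ x ⟧} {⟦ 𝟙 ⟧} {I.𝟙} (Equivalence.to (⟦⟧-kernel x 𝟙)
    (≼⇒∈ ≼𝟙 , ∈-resp (sym (𝟙⇒ x)) x∈F)) ⟦⟧-𝟙

  ⟦⟧≈𝟙⇒∈ : ∀ {x} → ⟦ x ⟧ ≈ᴵ I.𝟙 → x ∈ member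
  ⟦⟧≈𝟙⇒∈ {x} x≈𝟙 = ∈-resp (𝟙⇒ x)
    (proj₂ (Equivalence.from (⟦⟧-kernel x 𝟙) (I.trans {⟦ x ⟧} {I.𝟙} {⟦ 𝟙 ⟧} x≈𝟙 (swap ⟦⟧-𝟙))))

  ⇒∈⇒≼ : ∀ {x y} → (x ⇒ y) ∈ member → ⟦ x ⟧ ≼ᴵ ⟦ y ⟧
  ⇒∈⇒≼ {x} {y} x⇒y = I.trans {⟦ x ⟧ ⇒ᴵ ⟦ y ⟧} {⟦ x ⇒ y ⟧} {I.𝟙} (swap (⟦⟧-⇒ x y)) (∈⇒⟦⟧≈𝟙 x⇒y)

  ≼⇒⇒∈ : ∀ {x y} → ⟦ x ⟧ ≼ᴵ ⟦ y ⟧ → (x ⇒ y) ∈ member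
  ≼⇒⇒∈ {x} {y} x≼y = ⟦⟧≈𝟙⇒∈ (I.trans {⟦ x ⇒ y ⟧} {⟦ x ⟧ ⇒ᴵ ⟦ y ⟧} {I.𝟙} (⟦⟧-⇒ x y) x≼y)

  const⇒∈⇒≼ : ∀ r {x} → (const r ⇒ x) ∈ member → constᴵ r ≼ᴵ ⟦ x ⟧
  const⇒∈⇒≼ r {x} r⇒x = IP.≼-respˡ {⟦ const r ⟧} {constᴵ r} {⟦ x ⟧} (const-homo r) (⇒∈⇒≼ r⇒x)

  ∈lower⇒const⇒∈ : ∀ r {x} → proj₁ r ∈ lower ⟦ x ⟧ → (const r ⇒ x) ∈ member
  ∈lower⇒const⇒∈ r {x} r∈ = ≼⇒⇒∈ (IP.≼-respˡ {constᴵ r} {⟦ const r ⟧} {⟦ x ⟧} (swap (const-homo r))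
    (⊆⇒≼ᴵ (constᴵ r) ⟦ x ⟧ λ p<r → down ⟦ x ⟧ (<⇒≤ p<r) r∈))

module _ (em : ∀ {ℓ} → ExcludedMiddle ℓ) (A : PavelkaAlgebra c ℓ) where
  open Classical em
  open MaximalFilter using (member)

  -- The embedding is chosen separately for `F` and for `F′`, even when they have the same members.
  -- Their values can still be compared, since the rationals below x/F are detected by `const r ⇒ x`
  -- being in `F`.
  quotient-⊆ : ∀ {F F′ : SpecM A} → member F ⊆ member F′ → ∀ x → lower (quotient A x F) ⊆ lower (quotient A x F′)
  quotient-⊆ {F} {F′} F⊆F′ x {p} p∈ with p <? 0ℚ
  ... | yes p<0 = neg (quotient A x F′) p<0
  ... | no  p≮0 =
    let (r , p<r , r∈) = rounded (quotient A x F) p∈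
        rᴵ = r , ≤-trans (≮⇒≥ p≮0) (<⇒≤ p<r) , <⇒≤ (bounded (quotient A x F) r∈)
    in ≼ᴵ⇒⊆ (constᴵ rᴵ) (quotient A x F′)
         (Quotient.const⇒∈⇒≼ em A F′ rᴵ (F⊆F′ (Quotient.∈lower⇒const⇒∈ em A F rᴵ r∈))) p<r

  quotient-cong : ∀ {F F′ : SpecM A} → _≈ˢ_ {A = A} F F′ → ∀ x → quotient A x F ≈ᴵ quotient A x F′
  quotient-cong {F} {F′} (F⊆F′ , F′⊆F) x = quotient-⊆ {F} {F′} F⊆F′ x , quotient-⊆ {F′} {F} F′⊆F x

-- Meets under residuation, and the pair induced by a fuzzy relation.

module Meets (M : MVAlgebra c ℓ) where
  open MVAlgebra M
  open MVProperties M

  record IsMeet {I : Set i} (f : I → Carrier) (m : Carrier) : Set (c ⊔ ℓ ⊔ i) where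
    field
      below    : ∀ k → m ≼ f k
      greatest : ∀ x → (∀ k → x ≼ f k) → x ≼ m

  open IsMeet

  meet-mono : {I : Set i} {f g : I → Carrier} {m n : Carrier} →
    IsMeet f m → IsMeet g n → (∀ k → f k ≼ g k) → m ≼ n
  meet-mono {m = m} f-meet g-meet f≼g = greatest g-meet m λ k → ≼-trans (below f-meet k) (f≼g k)

  -- The map `r ⇒_` is right adjoint to `_· r` and hence preserves meets.
  meet-⇒ : ∀ {I : Set i} {f g : I → Carrier} {m n : Carrier} r →
    IsMeet f m → IsMeet g n → (∀ k → g k ≈ (r ⇒ f k)) → (r ⇒ m) ≈ n
  meet-⇒ {m = m} {n} r f-meet g-meet g≈r⇒f = ≼-antisym
    (greatest g-meet (r ⇒ m) λ k → ≼-respʳ (sym (g≈r⇒f k)) (⇒-mono ≼-refl (below f-meet k)))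
    (residuate (greatest f-meet (n · r) λ k → unresiduate (≼-respʳ (g≈r⇒f k) (below g-meet k))))

module Bounds (em : ∀ {ℓ} → ExcludedMiddle ℓ) where
  open Classical em
  open MVAlgebra (PavelkaAlgebra.mvAlgebra [0,1])
  open MVProperties (PavelkaAlgebra.mvAlgebra [0,1])
  open Meets (PavelkaAlgebra.mvAlgebra [0,1])

  ⋀-isMeet : {K : Set i} (f : K → 𝕀) → IsMeet f (⋀ f)
  ⋀-isMeet f = record { below = ⋀-lower f ; greatest = ⋀-greatest f }

  ⋀-mono : {K : Set i} (f g : K → 𝕀) → (∀ k → f k ≼ g k) → ⋀ f ≼ ⋀ g
  ⋀-mono f g = meet-mono (⋀-isMeet f) (⋀-isMeet g)

  ⋁-mono : {K : Set i} {L : Set j} (f : K → 𝕀) (g : L → 𝕀) (s : K → L) → (∀ k → f k ≼ g (s k)) → ⋁ f ≼ ⋁ g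
  ⋁-mono f g s f≼g = ⋁-least f (⋁ g) λ k → ≼-trans {f k} {g (s k)} {⋁ g} (f≼g k) (⋁-upper g (s k))

module FuzzyRelation (em : ∀ {ℓ} → ExcludedMiddle ℓ) {I : Set i} {J : Set j} where
  open Classical em
  open MVAlgebra (PavelkaAlgebra.mvAlgebra [0,1])
  open MVProperties (PavelkaAlgebra.mvAlgebra [0,1])
  open Meets (PavelkaAlgebra.mvAlgebra [0,1])
  open Bounds em

  -- Both sides of `galois` say that `x j · y i ≼ R i j` for all `i` and `j`; `⇒-swap` passes
  -- between the two residuated forms. `d-const` is currying under the meet.
  d⇌h : (R : I → J → 𝕀) → [ [0,1]^ I , [0,1]^ J ] d[ R ] ⇌ h[ R ]
  d⇌h R = record
    { d-antitone = λ {x} {y} x≼y j → ⋀-mono (λ i → y i ⇒ R i j) (λ i → x i ⇒ R i j)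
        λ i → ⇒-mono {y i} {x i} {R i j} {R i j} (x≼y i) (≼-refl {R i j})
    ; h-antitone = λ {x} {y} x≼y i → ⋀-mono (λ j → y j ⇒ R i j) (λ j → x j ⇒ R i j)
        λ j → ⇒-mono {y j} {x j} {R i j} {R i j} (x≼y j) (≼-refl {R i j})
    ; galois     = λ x y → mk⇔
        (λ x≼dy i → ⋀-greatest (λ j → x j ⇒ R i j) (y i) λ j →
          ⇒-swap {x j} {y i} {R i j} (≼-trans {x j} {d[ R ] y j} {y i ⇒ R i j} (x≼dy j) (⋀-lower (λ i → y i ⇒ R i j) i)))
        (λ y≼hx j → ⋀-greatest (λ i → y i ⇒ R i j) (x j) λ i →
          ⇒-swap {y i} {x j} {R i j} (≼-trans {y i} {h[ R ] x i} {x j ⇒ R i j} (y≼hx i) (⋀-lower (λ j → x j ⇒ R i j) j)))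
    ; d-const    = λ r x j → meet-⇒ (constᴵ r) (⋀-isMeet λ i → x i ⇒ R i j) (⋀-isMeet λ i → constᴵ r · x i ⇒ R i j)
        λ i → ⇒-curry (constᴵ r) (x i) (R i j)
    }

-- Symmetry of the relation between d and h.

module _ (A : PavelkaAlgebra c₁ ℓ₁) (B : PavelkaAlgebra c₂ ℓ₂) where
  private
    module A where
      open PavelkaAlgebra A using (mvAlgebra; const) public
      open MVAlgebra mvAlgebra public
      open MVProperties mvAlgebra public
    module B where
      open PavelkaAlgebra B using (mvAlgebra; const) public
      open MVAlgebra mvAlgebra public
      open MVProperties mvAlgebra public

  -- The work is in `d-const` for `h`. With r for the constant in either algebra, `x ≼ (r ⇒ h y)`
  -- means `y ≼ d (r · x)`, that is `y ≼ (r ⇒ d x)`, then `r · y ≼ d x`, and finally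
  -- `x ≼ h (r · y)`.
  ⇌-swap : {d : A.Carrier → B.Carrier} {h : B.Carrier → A.Carrier} → [ A , B ] d ⇌ h → [ B , A ] h ⇌ d
  ⇌-swap {d} {h} d⇌h = record
    { d-antitone = h-antitone
    ; h-antitone = d-antitone
    ; galois     = λ x y → mk⇔ from to
    ; d-const    = λ r y → A.≼-antisym (to (from-const r (A.⇒-swap A.≼-refl))) (A.⇒-swap (to-const r (from A.≼-refl)))
    }
    where
    open [_,_]_⇌_ d⇌h
    to : ∀ {x y} → x B.≼ d y → y A.≼ h x
    to = Equivalence.to (galois _ _)
    from : ∀ {x y} → y A.≼ h x → x B.≼ d y
    from = Equivalence.from (galois _ _)
    from-const : ∀ r {x y} → A.const r A.≼ (x A.⇒ h y) → B.const r B.· y B.≼ d x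
    from-const r {x} r≼ = B.unresiduate (B.⇒-swap (B.≼-respʳ (B.sym (d-const r x)) (from (A.unresiduate r≼))))
    to-const : ∀ r {x y} → B.const r B.· y B.≼ d x → A.const r A.≼ (x A.⇒ h y)
    to-const r {x} ry≼ = A.residuate (to (B.≼-respʳ (d-const r x) (B.⇒-swap (B.residuate ry≼))))

-- The representation of d by a fuzzy relation.

module Representation (em : ∀ {ℓ} → ExcludedMiddle ℓ) (zorn : ∀ {c ℓ₁ ℓ₂ p} → Zorn c ℓ₁ ℓ₂ p)
  (A : PavelkaAlgebra c₁ ℓ₁) (B : PavelkaAlgebra c₂ ℓ₂)
  (d : PavelkaAlgebra.Carrier A → PavelkaAlgebra.Carrier B)
  (h : PavelkaAlgebra.Carrier B → PavelkaAlgebra.Carrier A)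
  (d⇌h : [ A , B ] d ⇌ h) where
  open Classical em
  open Extension em
  open [_,_]_⇌_ d⇌h
  open MaximalFilter using (member)
  private
    module A where
      open PavelkaAlgebra A using (mvAlgebra; const) public
      open MVAlgebra mvAlgebra public
      open MVProperties mvAlgebra public
    module B where
      open PavelkaAlgebra B using (mvAlgebra; const) public
      open MVAlgebra mvAlgebra public
      open MVProperties mvAlgebra public
    module I where
      open MVAlgebra (PavelkaAlgebra.mvAlgebra [0,1]) public
      open MVProperties (PavelkaAlgebra.mvAlgebra [0,1]) public

  x≼hdx : ∀ x → x A.≼ h (d x)
  x≼hdx x = Equivalence.to (galois (d x) x) B.≼-refl

  term : SpecM A → SpecM B → A.Carrier → 𝕀
  term F G a = quotient B (d a) G ·ᴵ quotient A a F

  relation : SpecM A → SpecM B → 𝕀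
  relation F G = ⋁ (term F G)

  relation-cong : relation Preserves₂ _≈ˢ_ {A = A} ⟶ _≈ˢ_ {A = B} ⟶ _≈ᴵ_
  relation-cong {F} {F′} {G} {G′} F≈F′ G≈G′ = I.≼-antisym {relation F G} {relation F′ G′}
    (⋁-mono (term F G) (term F′ G′) id λ a → I.≼-reflexive {term F G a} {term F′ G′ a} (term-cong a))
    (⋁-mono (term F′ G′) (term F G) id λ a → I.≼-reflexive {term F′ G′ a} {term F G a} (swap (term-cong a)))
    where
    open Bounds em using (⋁-mono)
    term-cong : ∀ a → term F G a ≈ᴵ term F′ G′ a
    term-cong a = I.·-cong {quotient B (d a) G} {quotient B (d a) G′} {quotient A a F} {quotient A a F′}
      (quotient-cong em B {G} {G′} G≈G′ (d a)) (quotient-cong em A {F} {F′} F≈F′ a)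

  -- With U = { u ∣ d u ∈ G } and v = t · x ∉ U, the filter to extend consists of the y with
  -- y ∨ (v ⇒ u) = 𝟙 for some u ∈ U.
  separating-filter : ∀ (G : SpecM B) x t → (B.const t B.⇒ d x) ∉ member G →
    ∃ λ (F : SpecM A) → (A.∼ A.const t A.⇒ x) ∈ member F ×
      (∀ u → d u ∈ member G → (u A.⇒ A.const t A.· x) ∈ member F)
  separating-filter G x t t⇒dx∉G =
    let (F , H⊆F) = extend-to-maximal A.mvAlgebra zorn H-filter H-proper
    in F , H⊆F (resize (A.𝟘 , d𝟘∈G , ∼t⇒x-covers)) ,
       λ u du∈G → H⊆F (resize (u , du∈G , A.prelinear u v))
    where
    open IsFilter (MaximalFilter.isFilter G)
    open FilterProperties B.mvAlgebra (MaximalFilter.isFilter G)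

    v : A.Carrier
    v = A.const t A.· x

    H : Pred A.Carrier (c₁ ⊔ ℓ₁)
    H y = Resize (c₁ ⊔ ℓ₁) (∃ λ u → d u ∈ member G × y A.∨ (v A.⇒ u) A.≈ A.𝟙)

    d𝟘∈G : d A.𝟘 ∈ member G
    d𝟘∈G = upward (≈𝟙⇒∈ B.refl) (Equivalence.from (galois B.𝟙 A.𝟘) A.𝟘≼)

    -- Through the Galois connection, `d u · d w ≼ d (u ∨ w)` asks for `h (d u · d w)` to be an
    -- upper bound of `u` and `w`.
    d∨∈G : ∀ {u w} → d u ∈ member G → d w ∈ member G → d (u A.∨ w) ∈ member G
    d∨∈G {u} {w} du∈G dw∈G = upward (·-closed du∈G dw∈G) (Equivalence.from (galois _ _)
      (A.∨-least (Equivalence.to (galois _ _) (B.x·y≼x (d u) (d w)))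
                 (Equivalence.to (galois _ _) (B.x·y≼y (d u) (d w)))))

    -- Taking `u = 𝟘` works: `v ⇒ 𝟘` equals `x ⇒ ∼ t`, so the claim is prelinearity for `∼ t` and
    -- `x`.
    ∼t⇒x-covers : (A.∼ A.const t A.⇒ x) A.∨ (v A.⇒ A.𝟘) A.≈ A.𝟙
    ∼t⇒x-covers = A.∨-≈𝟙-mono A.≼-refl
      (A.≼-reflexive (A.sym (A.trans (A.⇒-curry _ _ _) (A.trans (A.∙-congˡ (A.x⇒𝟘 x)) (A.comm _ _)))))
      (A.prelinear (A.∼ A.const t) x)

    H-filter : IsFilter A.mvAlgebra H
    H-filter = record
      { nonempty = A.𝟙 , resize (A.𝟘 , d𝟘∈G , A.𝟙≼⇒≈𝟙 (A.x≼x∨y _ _))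
      ; upward   = λ y∈H y≼z → let (u , du∈G , eq) = unresize y∈H in
          resize (u , du∈G , A.∨-≈𝟙-mono y≼z A.≼-refl eq)
      ; ·-closed = λ y∈H z∈H → let (u , du∈G , eq) = unresize y∈H ; (w , dw∈G , eq′) = unresize z∈H in
          resize (u A.∨ w , d∨∈G du∈G dw∈G , A.∨-≈𝟙-·
            (A.∨-≈𝟙-mono A.≼-refl (A.⇒-mono A.≼-refl (A.x≼x∨y u w)) eq)
            (A.∨-≈𝟙-mono A.≼-refl (A.⇒-mono A.≼-refl (A.y≼x∨y u w)) eq′))
      }

    -- If `𝟘` were in `H`, some `u` with `d u` in `G` would lie above `v`; antitonicity would then
    -- put `d v`, which is `t ⇒ d x`, into `G`.
    H-proper : Proper A.mvAlgebra H
    H-proper all∈H =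
      let (u , du∈G , eq) = unresize (all∈H A.𝟘)
          v≼u = A.𝟙≼⇒≈𝟙 (A.≼-respˡ eq A.𝟘∨x≼x)
      in t⇒dx∉G (∈-resp (B.sym (d-const t x)) (upward du∈G (d-antitone v≼u)))

  -- By residuation each d(a)/G must lie below (a ⇒ v)/F. It suffices to test rationals q below
  -- d(a)/G: then `q ⇒ d a` is in `G`, `d-const` rewrites it as `d (q · a)`, and the hypothesis for
  -- `q · a` gives the bound after currying.
  relation-bound : ∀ F G v → (∀ u → d u ∈ member G → (u A.⇒ v) ∈ member F) → relation F G ≼ᴵ quotient A v F
  relation-bound F G v ideal⇒v = ⋁-least (term F G) F.⟦ v ⟧ λ a → I.unresiduate {G.⟦ d a ⟧} {F.⟦ a ⟧} {F.⟦ v ⟧}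
    (I.≼-respʳ {F.⟦ a A.⇒ v ⟧} {F.⟦ a ⟧ ⇒ᴵ F.⟦ v ⟧} {G.⟦ d a ⟧} (F.⟦⟧-⇒ a v) (⊆⇒≼ᴵ G.⟦ d a ⟧ F.⟦ a A.⇒ v ⟧ (below a)))
    where
    module F = Quotient em A F
    module G = Quotient em B G
    module GF = FilterProperties B.mvAlgebra (MaximalFilter.isFilter G)
    module FF = FilterProperties A.mvAlgebra (MaximalFilter.isFilter F)
    below : ∀ a → lower G.⟦ d a ⟧ ⊆ lower F.⟦ a A.⇒ v ⟧
    below a {p} p∈ with p <? 0ℚ
    ... | yes p<0 = neg F.⟦ a A.⇒ v ⟧ p<0
    ... | no  p≮0 =
      let (q , p<q , q∈) = rounded G.⟦ d a ⟧ p∈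
          qᴵ = q , ≤-trans (≮⇒≥ p≮0) (<⇒≤ p<q) , <⇒≤ (bounded G.⟦ d a ⟧ q∈)
          d[q·a]∈G = GF.∈-resp (d-const qᴵ a) (G.∈lower⇒const⇒∈ qᴵ q∈)
      in ≼ᴵ⇒⊆ (constᴵ qᴵ) F.⟦ a A.⇒ v ⟧
           (F.const⇒∈⇒≼ qᴵ (FF.∈-resp (A.⇒-curry _ _ _) (ideal⇒v _ d[q·a]∈G))) p<q

  -- x ⇒ t · x is t ∨ ∼ x.
  ⇒·-≼ : ∀ t x → (A.∼ t A.⇒ x) A.≼ ((x A.⇒ t A.· x) A.⇒ t)
  ⇒·-≼ t x = A.≼-respˡ (A.∙-congʳ (A.sym (A.∼-involutive t)))
    (A.≼-respʳ (A.∙-congʳ (A.∼-cong (A.trans (A.sym (A.łukasiewicz t (A.∼ x))) (A.comm _ _))))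
      (A.≼-respˡ (A.trans (A.∙-congʳ (A.∼-involutive x)) (A.comm _ _)) (A.⇒-swap A.≼-refl)))

  residual : SpecM B → A.Carrier → SpecM A → 𝕀
  residual G x F = quotient A x F ⇒ᴵ relation F G

  representation : ∀ x → PavelkaAlgebra._≈_ ([0,1]^ SpecM B) (n[ B ] (d x)) (d[ relation ] (n[ A ] x))
  representation x G = I.≼-antisym {G.⟦ d x ⟧} {d[ relation ] (n[ A ] x) G}
    (⋀-greatest (residual G x) G.⟦ d x ⟧ λ F → I.residuate {G.⟦ d x ⟧} {quotient A x F} {relation F G} (⋁-upper (term F G) x))
    (⊆⇒≼ᴵ (d[ relation ] (n[ A ] x) G) G.⟦ d x ⟧ λ p∈ → stable (absurd p∈))
    where
    module G = Quotient em B G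
    absurd : ∀ {p} → p ∈ lower (d[ relation ] (n[ A ] x) G) → ¬ (p ∉ lower G.⟦ d x ⟧)
    absurd {p} p∈ p∉ =
      -- Rounding `p` up to `t` excludes `t ⇒ d x` from `G`, since otherwise `p` would be in the cut
      -- of d(x)/G. At the resulting `F` the residual is at most `t`, while `t` is in its open cut,
      -- so `t < t`.
      let (t , p<t , t∈) = rounded (d[ relation ] (n[ A ] x) G) p∈
          0≤p = ≮⇒≥ λ p<0 → p∉ (neg G.⟦ d x ⟧ p<0)
          tᴵ  = t , ≤-trans 0≤p (<⇒≤ p<t) , <⇒≤ (bounded (d[ relation ] (n[ A ] x) G) t∈)
          (F , ∼t⇒x∈F , ideal⇒v) = separating-filter G x tᴵ
            λ t⇒dx∈G → p∉ (≼ᴵ⇒⊆ (constᴵ tᴵ) G.⟦ d x ⟧ (G.const⇒∈⇒≼ tᴵ t⇒dx∈G) p<t)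
      in <-irrefl ≡.refl (bound tᴵ F ∼t⇒x∈F ideal⇒v
           (≼ᴵ⇒⊆ (d[ relation ] (n[ A ] x) G) (quotient A x F ⇒ᴵ relation F G) (⋀-lower (residual G x) F) t∈))
      where
      -- Read from the last factor of the composition to the first: x/F → R(F,G) ≤ x/F → v/F = (x ⇒
      -- v)/F ≤ t/F = t.
      bound : ∀ t F → (A.∼ A.const t A.⇒ x) ∈ member F →
        (∀ u → d u ∈ member G → (u A.⇒ A.const t A.· x) ∈ member F) →
        lower (quotient A x F ⇒ᴵ relation F G) ⊆ (_< proj₁ t)
      bound t F ∼t⇒x∈F ideal⇒v =
        proj₁ (F.const-homo t) ∘
        ≼ᴵ⇒⊆ F.⟦ x A.⇒ v ⟧ F.⟦ A.const t ⟧ (F.⇒∈⇒≼ (IsFilter.upward (MaximalFilter.isFilter F) ∼t⇒x∈F (⇒·-≼ _ x))) ∘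
        proj₂ (F.⟦⟧-⇒ x v) ∘
        ≼ᴵ⇒⊆ (F.⟦ x ⟧ ⇒ᴵ relation F G) (F.⟦ x ⟧ ⇒ᴵ F.⟦ v ⟧)
          (I.⇒-mono {F.⟦ x ⟧} {F.⟦ x ⟧} {relation F G} {F.⟦ v ⟧} (I.≼-refl {F.⟦ x ⟧}) (relation-bound F G v ideal⇒v))
        where
        module F = Quotient em A F
        v = A.const t A.· x

-- The term at `a` is dominated by the swapped term at `d a`, because `a ≼ h (d a)` gives a/F ≤
-- h(d(a))/F.
relation-swap-≼ : ∀ (em : ∀ {ℓ} → ExcludedMiddle ℓ) (zorn : ∀ {c ℓ₁ ℓ₂ p} → Zorn c ℓ₁ ℓ₂ p)
  (A : PavelkaAlgebra c₁ ℓ₁) (B : PavelkaAlgebra c₂ ℓ₂) d h (d⇌h : [ A , B ] d ⇌ h) F G →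
  let open Classical em in
  Representation.relation em zorn A B d h d⇌h F G ≼ᴵ
  Representation.relation em zorn B A h d (⇌-swap A B d⇌h) G F
relation-swap-≼ em zorn A B d h d⇌h F G = Bounds.⋁-mono em (Representation.term em zorn A B d h d⇌h F G) (Representation.term em zorn B A h d (⇌-swap A B d⇌h) G F) d λ a →
  I.≼-respˡ {F.⟦ a ⟧ ·ᴵ G.⟦ d a ⟧} {G.⟦ d a ⟧ ·ᴵ F.⟦ a ⟧} {F.⟦ h (d a) ⟧ ·ᴵ G.⟦ d a ⟧} (I.·-comm F.⟦ a ⟧ G.⟦ d a ⟧)
    (I.·-mono {F.⟦ a ⟧} {F.⟦ h (d a) ⟧} {G.⟦ d a ⟧} {G.⟦ d a ⟧}
        (F.⇒∈⇒≼ (FF.≼⇒∈ (Representation.x≼hdx em zorn A B d h d⇌h a))) (I.≼-refl {G.⟦ d a ⟧}))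
  where
  open Classical em
  module F = Quotient em A F
  module G = Quotient em B G
  module FF = FilterProperties (PavelkaAlgebra.mvAlgebra A) (MaximalFilter.isFilter F)
  module I = MVProperties (PavelkaAlgebra.mvAlgebra [0,1])

-- The representation of h by the transposed relation, and the theorem.

module _ (em : ∀ {ℓ} → ExcludedMiddle ℓ) (zorn : ∀ {c ℓ₁ ℓ₂ p} → Zorn c ℓ₁ ℓ₂ p)
  (A : PavelkaAlgebra c₁ ℓ₁) (B : PavelkaAlgebra c₂ ℓ₂)
  (d : PavelkaAlgebra.Carrier A → PavelkaAlgebra.Carrier B)
  (h : PavelkaAlgebra.Carrier B → PavelkaAlgebra.Carrier A)
  (d⇌h : [ A , B ] d ⇌ h) where
  open Classical em
  private
    module D = Representation em zorn A B d h d⇌h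
    module H = Representation em zorn B A h d (⇌-swap A B d⇌h)
    module I where
      open MVAlgebra (PavelkaAlgebra.mvAlgebra [0,1]) public
      open MVProperties (PavelkaAlgebra.mvAlgebra [0,1]) public

  -- Here the comparison of the two relations is applied to the swapped pair; swapping twice
  -- restores `d`, hence the original relation.
  residual-≼ : ∀ y F G → H.residual F y G ≼ᴵ (quotient B y G ⇒ᴵ D.relation F G)
  residual-≼ y F G = I.⇒-mono {quotient B y G} {quotient B y G} {H.relation G F} {D.relation F G} (I.≼-refl {quotient B y G})
    (relation-swap-≼ em zorn B A h d (⇌-swap A B d⇌h) G F)

  residual-≽ : ∀ y F G → (quotient B y G ⇒ᴵ D.relation F G) ≼ᴵ H.residual F y G
  residual-≽ y F G = I.⇒-mono {quotient B y G} {quotient B y G} {D.relation F G} {H.relation G F} (I.≼-refl {quotient B y G})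
    (relation-swap-≼ em zorn A B d h d⇌h F G)

  dual-representation : ∀ y → PavelkaAlgebra._≈_ ([0,1]^ SpecM A) (n[ A ] (h y)) (h[ D.relation ] (n[ B ] y))
  dual-representation y F = I.trans {quotient A (h y) F} {d[ H.relation ] (n[ B ] y) F} {h[ D.relation ] (n[ B ] y) F}
    (H.representation y F)
    (I.≼-antisym {d[ H.relation ] (n[ B ] y) F} {h[ D.relation ] (n[ B ] y) F}
      (Bounds.⋀-mono em (H.residual F y) (λ G → quotient B y G ⇒ᴵ D.relation F G) (residual-≼ y F))
      (Bounds.⋀-mono em (λ G → quotient B y G ⇒ᴵ D.relation F G) (H.residual F y) (residual-≽ y F)))

theorem7 :
  (em : ∀ {ℓ} → ExcludedMiddle ℓ) (zorn : ∀ {c ℓ₁ ℓ₂ p} → Zorn c ℓ₁ ℓ₂ p) →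
  ∀ {i j c₁ ℓ₁ c₂ ℓ₂ k₁ s₁ t₁ k₂ s₂ t₂ : Level} →
  let open Classical em in
  ( (I : Set i) (J : Set j) (R : I → J → 𝕀) →
    [ [0,1]^ I , [0,1]^ J ] d[ R ] ⇌ h[ R ] )
  ×
  ( (A : PavelkaAlgebra c₁ ℓ₁) (B : PavelkaAlgebra c₂ ℓ₂) →
    Semisimple A k₁ s₁ t₁ → Semisimple B k₂ s₂ t₂ →
    let module A = PavelkaAlgebra A
        module B = PavelkaAlgebra B
    in
    (d : A.Carrier → B.Carrier) (h : B.Carrier → A.Carrier) → [ A , B ] d ⇌ h →
    ∃ λ (R : SpecM A → SpecM B → 𝕀) →
      R Preserves₂ _≈ˢ_ {A = A} ⟶ _≈ˢ_ {A = B} ⟶ _≈ᴵ_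
      × (∀ F G → R F G ≈ᴵ ⋁ λ a → quotient B (d a) G ·ᴵ quotient A a F)
      × (∀ x → PavelkaAlgebra._≈_ ([0,1]^ SpecM B) (n[ B ] (d x)) (d[ R ] (n[ A ] x)))
      × (∀ y → PavelkaAlgebra._≈_ ([0,1]^ SpecM A) (n[ A ] (h y)) (h[ R ] (n[ B ] y))) )
theorem7 em zorn =
  -- Rebuilding the record spares the type checker a comparison of the power algebras.
  (λ I J R → let open [_,_]_⇌_ (FuzzyRelation.d⇌h em {I = I} {J = J} R) in record
    { d-antitone = λ {x} {y} → d-antitone {x} {y}
    ; h-antitone = λ {x} {y} → h-antitone {x} {y}
    ; galois     = galois
    ; d-const    = d-const
    }) ,
  λ A B _ _ d h d⇌h →
    let open Representation em zorn A B d h d⇌h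
    in relation , (λ {F} {F′} {G} {G′} → relation-cong {F} {F′} {G} {G′}) , (λ F G → id , id) ,
       representation , dual-representation em zorn A B d h d⇌h
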